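{- Let $n\ge 7$. There exists an almost peripheral graph of order $n$ with maximum degree $\Delta$ if and only if $\Delta\in\{3,4,\ldots,n-4,\,n-1\}$.
   Context: All graphs are finite and simple. For a connected graph $G$, the eccentricity of a vertex $v$ is $\max_{u\in V(G)} d(v,u)$; the diameter is the maximum eccentricity. A peripheral vertex is one whose eccentricity equals the diameter. A connected graph of order $n$ is almost peripheral if it has exactly $n-1$ peripheral vertices. -}

module Defs where

open import Data.Nat using (ℕ; zero; suc; _+_; _≤_)
open import Data.Fin using (Fin)
open import Data.Bool using (Bool; true; false; if_then_else_)
open import Data.List using (List; map; allFin)
open import Data.Nat.ListAction using (sum)
open import Data.Product using (Σ; ∃; _×_)
open import Relation.Binary.PropositionalEquality using (_≡_; _≢_)
open import Relation.Nullary using (¬_)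

record Graph (n : ℕ) : Set where
  field
    adj   : Fin n → Fin n → Bool
    sym   : ∀ u v → adj u v ≡ adj v u
    irrefl : ∀ v → adj v v ≡ false
open Graph public

module _ {n : ℕ} (G : Graph n) where

  Adj : Fin n → Fin n → Set
  Adj u v = adj G u v ≡ true

  data Walk : Fin n → Fin n → ℕ → Set where
    here : ∀ {v} → Walk v v 0
    step : ∀ {u w v k} → Adj u w → Walk w v k → Walk u v (suc k)

  DistLe : Fin n → Fin n → ℕ → Set
  DistLe u v k = Σ ℕ λ j → j ≤ k × Walk u v j

  Connected : Set
  Connected = ∀ u v → Σ ℕ λ k → Walk u v k

  EccLe : Fin n → ℕ → Set
  EccLe v k = ∀ u → DistLe v u k

  IsEcc : Fin n → ℕ → Set
  IsEcc v e = EccLe v e × (∀ k → EccLe v k → e ≤ k)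

  IsDiam : ℕ → Set
  IsDiam D = (∀ v → EccLe v D) × (∀ k → (∀ v → EccLe v k) → D ≤ k)

  Peripheral : Fin n → Set
  Peripheral v = Σ ℕ λ D → IsDiam D × IsEcc v D

  -- exactly n-1 peripheral vertices: exactly one vertex is not peripheral
  AlmostPeripheral : Set
  AlmostPeripheral = Connected × Σ (Fin n) λ c → ¬ Peripheral c × (∀ v → v ≢ c → Peripheral v)

  degree : Fin n → ℕ
  degree v = sum (map (λ u → if adj G v u then 1 else 0) (allFin n))

  MaxDegree : ℕ → Set
  MaxDegree Δ = (∀ v → degree v ≤ Δ) × Σ (Fin n) λ v → degree v ≡ Δ

{-# OPTIONS --safe #-}
module Submission where

-- Let c be the non-peripheral vertex, e its eccentricity, e + 1 the diameter; any vertex of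
-- eccentricity at most e is c. If e ≤ 1 then c dominates and Δ = n − 1. Let e ≥ 2.
-- If a vertex v has at most two non-neighbours, then chasing short walks produces either two
-- vertices of eccentricity ≤ 2 or a vertex of degree larger than that of v.
-- If all degrees are at most 2, take a neighbour a of c and y at distance e + 1 from a. The walk
-- from c to y starts at some b ≠ a, and on the side of b each distance from c is attained only
-- once. A second neighbour of y would be on that side too, and at no possible level; but if y is
-- a leaf, its neighbour has eccentricity ≤ e.
--
-- Conversely, a twin of a vertex x ≠ c keeps the graph almost peripheral and raises only the
-- degrees of the neighbours of x. So the path on three vertices gives Δ = n − 1, and the other
-- cases reduce to Δ = 3. For n = 4m + 4 take two cycles a, b of length 2m + 1, the edge aₘ bₘ, and
-- a vertex c adjacent to a₀, b₀ and a leaf: the radius is m + 1 and the diameter m + 2. Twins of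
-- vertices of degree 2 fill in the remaining orders n ≥ 20, and smaller orders are sporadic.

open import Defs
open import Data.Bool using (Bool; true; false; not; T; _∧_; _∨_; if_then_else_)
open import Data.Bool.ListAction using (any)
open import Data.Bool.Properties using (¬-not; not-¬; not-injective; ∨-comm) renaming (_≟_ to _≟ᵇ_)
open import Data.Empty using (⊥; ⊥-elim)
open import Data.Fin using (Fin; zero; suc; toℕ; #_; _↑ˡ_; _↑ʳ_; splitAt; fromℕ; fromℕ<)
open import Data.Fin.Properties
  using (suc-injective; all?; any?; ¬∀⟶∃¬; splitAt-↑ˡ; splitAt-↑ʳ; splitAt⁻¹-↑ˡ; splitAt⁻¹-↑ʳ;
         toℕ-fromℕ; toℕ-fromℕ<; toℕ-injective; toℕ<n)
  renaming (_≟_ to _≟ᶠ_)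
open import Data.List using (List; []; _∷_; _++_; length; map; filter; concatMap; allFin)
open import Data.List.Properties using (length-++; length-map; length-tabulate; map-tabulate)
import Data.List.Membership.DecPropositional as DecMembership
open import Data.List.Membership.Propositional using (_∈_; find; lose)
open import Data.List.Membership.Propositional.Properties
  using (∈-filter⁺; ∈-filter⁻; ∈-allFin; ∈-map⁻; ∈-++⁺ˡ; ∈-++⁺ʳ; ∈-++⁻; ∈-concatMap⁺; ∈-concatMap⁻; ∈-∃++)
open import Data.List.Relation.Unary.All as All using (All; []; _∷_)
open import Data.List.Relation.Unary.AllPairs using ([]; _∷_)
open import Data.List.Relation.Unary.Any using (here; there)
open import Data.List.Relation.Unary.Unique.Propositional using (Unique)
import Data.List.Relation.Unary.Unique.Propositional.Properties as Unique
open import Data.Nat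
  using (ℕ; zero; suc; _+_; _∸_; _*_; _⊓_; ∣_-_∣; _≤_; _<_; z≤n; s≤s; s≤s⁻¹; _≟_; _≤?_; _<ᵇ_; _≡ᵇ_)
open import Data.Nat.DivMod using (_divMod_; result)
open import Data.Nat.ListAction using (sum)
open import Data.Nat.Properties hiding (suc-injective)
open import Data.Nat.Tactic.RingSolver using (solve-∀)
open import Data.Product using (Σ; ∃; ∃₂; _×_; _,_; proj₁; proj₂)
open import Data.Sum using (_⊎_; inj₁; inj₂; [_,_]′; swap)
open import Data.Unit using (⊤; tt)
open import Function using (_∘_; id; case_of_)
open import Function.Bundles using (_⇔_; mk⇔)
open import Function.Definitions using (Injective)
open import Relation.Binary.Definitions using (tri<; tri≈; tri>)
open import Relation.Binary.PropositionalEquality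
  using (_≡_; _≢_; refl; trans; cong; cong₂; subst; subst₂) renaming (sym to ≡-sym)
open import Relation.Nullary using (Dec; yes; no; ¬_; ¬?; _×-dec_; _⊎-dec_; _→-dec_; does)
open import Relation.Nullary.Decidable
  using (True; toWitness; map′; decidable-stable; does-⇔; dec-true; dec-false)

private
  variable
    n : ℕ
    A B : Set

-- Counting

-- Induction on the first list: cutting its head `x` out of `ys` loses none of the remaining
-- entries, which all differ from `x`.
unique⊆⇒length≤ : {xs ys : List A} → Unique xs → (∀ {x} → x ∈ xs → x ∈ ys) → length xs ≤ length ys
unique⊆⇒length≤ [] _ = z≤n
unique⊆⇒length≤ {xs = x ∷ xs} (x≢ ∷ u) sub with ∈-∃++ (sub (here refl))
... | ps , qs , refl = begin
    suc (length xs)          ≤⟨ s≤s (unique⊆⇒length≤ u sub′) ⟩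
    suc (length (ps ++ qs))  ≡⟨ cong suc (length-++ ps) ⟩
    suc (length ps + length qs) ≡⟨ ≡-sym (+-suc (length ps) _) ⟩
    length ps + suc (length qs) ≡⟨ ≡-sym (length-++ ps) ⟩
    length (ps ++ x ∷ qs) ∎
  where
  open ≤-Reasoning
  sub′ : ∀ {y} → y ∈ xs → y ∈ ps ++ qs
  sub′ y∈ with ∈-++⁻ ps (sub (there y∈))
  ... | inj₁ p = ∈-++⁺ˡ p
  ... | inj₂ (here refl) = ⊥-elim (All.lookup x≢ y∈ refl)
  ... | inj₂ (there q) = ∈-++⁺ʳ ps q

length-allFin : ∀ n → length (allFin n) ≡ n
length-allFin n = length-tabulate id

module _ (G : Graph n) where

  Adj? : ∀ u v → Dec (Adj G u v)
  Adj? u v = adj G u v ≟ᵇ true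

  Adj-sym : ∀ {u v} → Adj G u v → Adj G v u
  Adj-sym {u} {v} p = trans (sym G v u) p

  Adj-irrefl : ∀ {v} → ¬ Adj G v v
  Adj-irrefl {v} p with trans (≡-sym p) (irrefl G v)
  ... | ()

  neighbours : Fin n → List (Fin n)
  neighbours v = filter (Adj? v) (allFin n)

  ∈-neighbours⁺ : ∀ {u v} → Adj G u v → v ∈ neighbours u
  ∈-neighbours⁺ {u} {v} p = ∈-filter⁺ (Adj? u) (∈-allFin v) p

  ∈-neighbours⁻ : ∀ {u v} → v ∈ neighbours u → Adj G u v
  ∈-neighbours⁻ {u} v∈ = proj₂ (∈-filter⁻ (Adj? u) {xs = allFin n} v∈)

  neighbours-unique : ∀ v → Unique (neighbours v)
  neighbours-unique v = Unique.filter⁺ (Adj? v) (Unique.allFin⁺ n)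

  degree≡length : ∀ v → degree G v ≡ length (neighbours v)
  degree≡length v = go (allFin n)
    where
    go : ∀ xs → sum (map (λ u → if adj G v u then 1 else 0) xs) ≡ length (filter (Adj? v) xs)
    go [] = refl
    go (x ∷ xs) with adj G v x
    ... | true  = cong suc (go xs)
    ... | false = go xs

  length≤degree : ∀ {v xs} → Unique xs → All (Adj G v) xs → length xs ≤ degree G v
  length≤degree {v} u a =
    ≤-trans (unique⊆⇒length≤ u (∈-neighbours⁺ ∘ All.lookup a)) (≤-reflexive (≡-sym (degree≡length v)))

  -- The injection `f` lets neighbours be listed by coordinates in another type, as is done for the
  -- ring graphs with `code`.
  degree≤length : ∀ {v} {f : Fin n → B} → Injective _≡_ _≡_ f → ∀ ys →
                  (∀ u → Adj G v u → f u ∈ ys) → degree G v ≤ length ys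
  degree≤length {v = v} {f} inj ys h = begin
      degree G v                     ≡⟨ degree≡length v ⟩
      length (neighbours v)          ≡⟨ ≡-sym (length-map f (neighbours v)) ⟩
      length (map f (neighbours v))  ≤⟨ unique⊆⇒length≤ (Unique.map⁺ inj (neighbours-unique v)) sub ⟩
      length ys ∎
    where
    open ≤-Reasoning
    sub : ∀ {y} → y ∈ map f (neighbours v) → y ∈ ys
    sub y∈ with ∈-map⁻ f y∈
    ... | u , u∈ , refl = h u (∈-neighbours⁻ u∈)

  order≤length+degree : ∀ {v} xs → (∀ u → u ∈ xs ⊎ Adj G v u) → n ≤ length xs + degree G v
  order≤length+degree {v} xs h = begin
      n                                 ≡⟨ ≡-sym (length-allFin n) ⟩
      length (allFin n)                 ≤⟨ unique⊆⇒length≤ (Unique.allFin⁺ n) (λ {x} _ → sub x) ⟩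
      length (xs ++ neighbours v)       ≡⟨ length-++ xs ⟩
      length xs + length (neighbours v) ≡⟨ cong (length xs +_) (≡-sym (degree≡length v)) ⟩
      length xs + degree G v ∎
    where
    open ≤-Reasoning
    sub : ∀ x → x ∈ xs ++ neighbours v
    sub x = [ ∈-++⁺ˡ , ∈-++⁺ʳ xs ∘ ∈-neighbours⁺ ]′ (h x)

  -- `xs`, `v` and the neighbours of `v` partition the vertices, so a lower bound on the length of
  -- `xs` becomes an upper bound on the degree.
  non-neighbours : ∀ v → ∃ λ xs → length xs + suc (degree G v) ≤ n × All (λ w → w ≢ v × ¬ Adj G v w) xs
                                   × (∀ u → u ≡ v ⊎ u ∈ xs ⊎ Adj G v u)
  non-neighbours v = xs , count , All.tabulate (proj₂ ∘ ∈-filter⁻ P? {xs = allFin n}) , cover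
    where
    open ≤-Reasoning
    P? : ∀ w → Dec (w ≢ v × ¬ Adj G v w)
    P? w = map′ (λ h → (h ∘ inj₁) , (h ∘ inj₂)) (λ { (a , b) → [ a , b ]′ }) (¬? (dec w))
      where
      dec : ∀ w → Dec (w ≡ v ⊎ Adj G v w)
      dec w with w ≟ᶠ v | Adj? v w
      ... | yes p | _     = yes (inj₁ p)
      ... | no _  | yes q = yes (inj₂ q)
      ... | no p  | no q  = no [ p , q ]′
    xs : List (Fin n)
    xs = filter P? (allFin n)
    unique : Unique (xs ++ v ∷ neighbours v)
    unique = Unique.++⁺ (Unique.filter⁺ P? (Unique.allFin⁺ n))
               (All.tabulate (λ { u∈ refl → Adj-irrefl (∈-neighbours⁻ u∈) }) ∷ neighbours-unique v)
               disjoint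
      where
      disjoint : ∀ {u} → ¬ (u ∈ xs × u ∈ v ∷ neighbours v)
      disjoint (u∈ , w∈) with proj₂ (∈-filter⁻ P? {xs = allFin n} u∈) | w∈
      ... | a , _ | here p  = a p
      ... | _ , b | there q = b (∈-neighbours⁻ q)
    count : length xs + suc (degree G v) ≤ n
    count = begin
      length xs + suc (degree G v)            ≡⟨ cong (λ k → length xs + suc k) (degree≡length v) ⟩
      length xs + length (v ∷ neighbours v)   ≡⟨ ≡-sym (length-++ xs) ⟩
      length (xs ++ v ∷ neighbours v)         ≤⟨ unique⊆⇒length≤ unique (λ {x} _ → ∈-allFin x) ⟩
      length (allFin n)                       ≡⟨ length-allFin n ⟩
      n ∎
    cover : ∀ u → u ≡ v ⊎ u ∈ xs ⊎ Adj G v u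
    cover u with u ≟ᶠ v | Adj? v u
    ... | yes p | _     = inj₁ p
    ... | no _  | yes q = inj₂ (inj₂ q)
    ... | no p  | no q  = inj₂ (inj₁ (∈-filter⁺ P? (∈-allFin u) (p , q)))

-- Walks and distances

  walk-++ : ∀ {u v w j k} → Walk G u v j → Walk G v w k → Walk G u w (j + k)
  walk-++ here       q = q
  walk-++ (step a p) q = step a (walk-++ p q)

  walk-snoc : ∀ {u v w k} → Walk G u v k → Adj G v w → Walk G u w (suc k)
  walk-snoc here       b = step b here
  walk-snoc (step a p) b = step a (walk-snoc p b)

  walk-reverse : ∀ {u v k} → Walk G u v k → Walk G v u k
  walk-reverse here       = here
  walk-reverse (step a p) = walk-snoc (walk-reverse p) (Adj-sym a)

  walk-unsnoc : ∀ {u v k} → Walk G u v (suc k) → ∃ λ w → Walk G u w k × Adj G w v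
  walk-unsnoc (step a here) = _ , here , a
  walk-unsnoc (step a p@(step _ _)) with walk-unsnoc p
  ... | w , q , b = w , step a q , b

  walk-preserves : (P : Fin n → Set) → (∀ {u w} → Adj G u w → P u → P w) →
                   ∀ {u v k} → Walk G u v k → P u → P v
  walk-preserves P h here       p = p
  walk-preserves P h (step a w) p = walk-preserves P h w (h a p)

  dist-refl : ∀ {v k} → DistLe G v v k
  dist-refl = 0 , z≤n , here

  dist-adj : ∀ {u v k} → Adj G u v → DistLe G u v (suc k)
  dist-adj a = 1 , s≤s z≤n , step a here

  dist-mono : ∀ {u v j k} → j ≤ k → DistLe G u v j → DistLe G u v k
  dist-mono j≤k (i , i≤j , p) = i , ≤-trans i≤j j≤k , p

  dist-sym : ∀ {u v k} → DistLe G u v k → DistLe G v u k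
  dist-sym (i , i≤k , p) = i , i≤k , walk-reverse p

  dist-step : ∀ {u w v k} → Adj G u w → DistLe G w v k → DistLe G u v (suc k)
  dist-step a (i , i≤k , p) = suc i , s≤s i≤k , step a p

  dist-snoc : ∀ {u w v k} → DistLe G u w k → Adj G w v → DistLe G u v (suc k)
  dist-snoc (i , i≤k , p) a = suc i , s≤s i≤k , walk-snoc p a

  dist-two : ∀ {u w v k} → Adj G u w → Adj G w v → DistLe G u v (suc (suc k))
  dist-two a b = dist-step a (dist-adj b)

  -- Repetitions are harmless, because only membership matters: it makes `DistLe` decidable.
  ball : ℕ → Fin n → List (Fin n)
  ball zero    v = v ∷ []
  ball (suc k) v = v ∷ concatMap (ball k) (neighbours v)

  ∈-ball⁺ : ∀ {k u v} → DistLe G u v k → v ∈ ball k u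
  ∈-ball⁺ {zero}  (_ , z≤n , here) = here refl
  ∈-ball⁺ {suc k} (_ , _ , here) = here refl
  ∈-ball⁺ {suc k} (_ , s≤s i≤k , step {w = w} a p) =
    there (∈-concatMap⁺ (ball k) (lose (∈-neighbours⁺ a) (∈-ball⁺ (_ , i≤k , p))))

  ∈-ball⁻ : ∀ {k u v} → v ∈ ball k u → DistLe G u v k
  ∈-ball⁻ {zero}  (here refl) = dist-refl
  ∈-ball⁻ {suc k} (here refl) = dist-refl
  ∈-ball⁻ {suc k} {u} (there v∈) with find (∈-concatMap⁻ (ball k) {xs = neighbours u} v∈)
  ... | w , w∈ , v∈′ = dist-step (∈-neighbours⁻ w∈) (∈-ball⁻ v∈′)

  DistLe? : ∀ u v k → Dec (DistLe G u v k)
  DistLe? u v k = map′ ∈-ball⁻ ∈-ball⁺ (v ∈? ball k u)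
    where open DecMembership (_≟ᶠ_ {n}) using (_∈?_)

  EccLe? : ∀ v k → Dec (EccLe G v k)
  EccLe? v k = all? (λ u → DistLe? v u k)

  ecc-mono : ∀ {v j k} → j ≤ k → EccLe G v j → EccLe G v k
  ecc-mono j≤k h u = dist-mono j≤k (h u)

  ¬ecc⇒far : ∀ {v k} → ¬ EccLe G v k → ∃ λ u → ¬ DistLe G v u k
  ¬ecc⇒far {v} {k} = ¬∀⟶∃¬ n (λ u → DistLe G v u k) (λ u → DistLe? v u k)

-- Almost peripheral graphs in terms of eccentricity bounds.

-- c is the non-peripheral vertex and e + 1 the diameter.
record AlmostPeripheralAt (G : Graph n) (c : Fin n) (e : ℕ) : Set where
  field
    centre-ecc : EccLe G c e
    ecc≤       : ∀ v → EccLe G v (suc e)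
    ecc>       : ∀ {v} → v ≢ c → ¬ EccLe G v e
open AlmostPeripheralAt

other-vertex : 2 ≤ n → (c : Fin n) → ∃ (_≢ c)
other-vertex (s≤s (s≤s _)) zero    = suc zero , λ ()
other-vertex (s≤s (s≤s _)) (suc _) = zero , λ ()

-- A vertex other than `c` provides the diameter. If it were 0, `c` would be peripheral; if it is e
-- + 1 and `c` is not within `e` of every vertex, then `c` attains it and is peripheral again.
almostPeripheral⇒at : (G : Graph n) → 2 ≤ n → AlmostPeripheral G → ∃₂ (AlmostPeripheralAt G)
almostPeripheral⇒at G 2≤n (_ , c , c-not , others) =
    go (others v v≢c)
  where
  v   = proj₁ (other-vertex 2≤n c)
  v≢c = proj₂ (other-vertex 2≤n c)
  go : Peripheral G v → ∃₂ (AlmostPeripheralAt G)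
  go (zero , diam , _) = ⊥-elim (c-not (0 , diam , proj₁ diam c , λ _ _ → z≤n))
  go (suc e , diam@(bound , least) , _) with EccLe? G c e
  ... | yes p = c , e , record
    { centre-ecc = p ; ecc≤ = bound
    ; ecc> = λ w≢c q → case others _ w≢c of λ where
        (_ , diam′ , _ , least′) → <-irrefl refl (≤-trans (least _ (proj₁ diam′)) (least′ e q)) }
  ... | no ¬p = ⊥-elim (c-not (suc e , diam , bound c ,
      λ k q → ≰⇒> (λ k≤e → ¬p (ecc-mono G k≤e q))))

-- The vertex `v` forces the diameter to be e + 1 and not less; in a graph consisting of `c` alone,
-- `c` would be peripheral.
at⇒almostPeripheral : (G : Graph n) {c v : Fin n} {e : ℕ} → v ≢ c →
                      AlmostPeripheralAt G c e → AlmostPeripheral G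
at⇒almostPeripheral G {c} {v} {e} v≢c ap =
    (λ u w → case ecc≤ ap u w of λ { (k , _ , p) → k , p })
  , c
  , (λ { (D , (bound , _) , _ , least) → ecc> ap v≢c (ecc-mono G (least e (centre-ecc ap)) (bound v)) })
  , λ w w≢c → suc e , (ecc≤ ap , λ k bound → far v≢c (bound v)) , ecc≤ ap w , λ k → far w≢c
  where
  far : ∀ {w k} → w ≢ c → EccLe G w k → suc e ≤ k
  far w≢c q = ≰⇒> (λ k≤e → ecc> ap w≢c (ecc-mono G k≤e q))

module _ (G : Graph n) {c : Fin n} {e : ℕ} (ap : AlmostPeripheralAt G c e) where

  ecc≤⇒≡centre : ∀ {v k} → k ≤ e → EccLe G v k → v ≡ c
  ecc≤⇒≡centre {v} k≤e p with v ≟ᶠ c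
  ... | yes q = q
  ... | no q  = ⊥-elim (ecc> ap q (ecc-mono G k≤e p))

  e≤1⇒dominating : e ≤ 1 → n ≤ suc (degree G c)
  e≤1⇒dominating e≤1 = order≤length+degree G (c ∷ []) λ u → case ecc-mono G e≤1 (centre-ecc ap) u of λ where
    (zero , _ , here) → inj₁ (here refl)
    (suc zero , _ , step a here) → inj₂ a
    (suc (suc _) , s≤s () , _)

-- Graphs of maximum degree at most two

module _ (G : Graph n) {c : Fin n} {e : ℕ} (ap : AlmostPeripheralAt G c e) (2≤n : 2 ≤ n)
         (deg≤2 : ∀ v → degree G v ≤ 2) where

  three-neighbours : ∀ {v x y z} → Adj G v x → Adj G v y → Adj G v z →
                     x ≢ y → x ≢ z → y ≢ z → ⊥
  three-neighbours {v} a b d x≢y x≢z y≢z = <-irrefl refl (≤-trans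
    (length≤degree G ((x≢y ∷ x≢z ∷ []) ∷ (y≢z ∷ []) ∷ [] ∷ []) (a ∷ b ∷ d ∷ [])) (deg≤2 v))

  module Branch {b} (c~b : Adj G c b) where

    -- Since `c` and `b` are adjacent, these vertices are at distance exactly k + 1 from `c`, with a
    -- shortest walk through `b`.
    Level : ℕ → Fin n → Set
    Level k z = Walk G b z k × ¬ DistLe G c z k

    predecessor : ∀ {w k} → Walk G b w k → ∃ λ x → Adj G w x × DistLe G c x k
    predecessor here = c , Adj-sym G c~b , dist-refl G
    predecessor p@(step _ _) with walk-unsnoc G p
    ... | x , q , x~w = x , Adj-sym G x~w , dist-step G c~b (_ , ≤-refl , q)

    -- Two vertices at level k + 1, together with the predecessor towards c, would be three
    -- neighbours of the unique vertex at level k.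
    level-unique : ∀ k {z z′} → Level k z → Level k z′ → z ≡ z′
    level-unique zero    (here , _) (here , _) = refl
    level-unique (suc k) {z} {z′} (p , c≁z) (p′ , c≁z′) with walk-unsnoc G p | walk-unsnoc G p′
    ... | w , q , w~z | w′ , q′ , w′~z′
      with level-unique k (q , λ d → c≁z (dist-snoc G d w~z)) (q′ , λ d → c≁z′ (dist-snoc G d w′~z′))
         | predecessor q
    ... | refl | x , w~x , d = decidable-stable (z ≟ᶠ z′) λ z≢z′ →
          three-neighbours w~z w′~z′ w~x z≢z′
            (λ { refl → c≁z (dist-mono G (n≤1+n k) d) })
            (λ { refl → c≁z′ (dist-mono G (n≤1+n k) d) })

  module Antipode {a y : Fin n} (c~a : Adj G c a) (far : ¬ DistLe G a y e) where

    a~c : Adj G a c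
    a~c = Adj-sym G c~a

    -- Together with `centre-ecc` this puts `y` at distance exactly `e` from `c`.
    c-far : ∀ {k} → suc k ≤ e → ¬ DistLe G c y k
    c-far k<e d = far (dist-mono G k<e (dist-step G a~c d))

    module _ {b : Fin n} {j : ℕ} (c~b : Adj G c b) (p : Walk G b y (suc j)) (e≡ : e ≡ suc (suc j)) where
      open Branch c~b

      -- On the side of `b`, the vertex `m` lies at level `j` and `y` at level j + 1.
      m = proj₁ (walk-unsnoc G p)
      b⇝m : Walk G b m j
      b⇝m = proj₁ (proj₂ (walk-unsnoc G p))
      m~y : Adj G m y
      m~y = proj₂ (proj₂ (walk-unsnoc G p))

      e≥ : suc (suc j) ≤ e
      e≥ = ≤-reflexive (≡-sym e≡)

      a≢b : a ≢ b
      a≢b refl = far (suc j , ≤-trans (n≤1+n _) e≥ , p)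

      -- Were `m` the only neighbour of `y`, every nonempty walk from `y` would start with it, so
      -- `m` would have eccentricity at most `e` and be `c`. But `y` is at distance `e`, at least 2,
      -- from `c`.
      second-neighbour : ∃ λ z → Adj G y z × z ≢ m
      second-neighbour with any? (λ z → Adj? G y z ×-dec ¬? (z ≟ᶠ m))
      ... | yes q = q
      ... | no leaf = ⊥-elim (c-far (≤-trans (s≤s (s≤s z≤n)) e≥)
              (subst (λ v → DistLe G v y 1) (ecc≤⇒≡centre G ap ≤-refl m-ecc) (dist-adj G m~y)))
        where
        m-ecc : EccLe G m e
        m-ecc u with u ≟ᶠ y
        ... | yes refl = dist-mono G (≤-trans (s≤s z≤n) e≥) (dist-adj G {k = 0} m~y)
        ... | no u≢y with ecc≤ ap y u
        ...   | _ , _ , here = ⊥-elim (u≢y refl)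
        ...   | suc i , s≤s i≤e , step {w = w} y~w q with w ≟ᶠ m
        ...     | yes refl = i , i≤e , q
        ...     | no w≢m   = ⊥-elim (leaf (w , y~w , w≢m))

      module _ {z : Fin n} (y~z : Adj G y z) where

        a-far : ¬ DistLe G a z (suc j)
        a-far d = far (dist-mono G e≥ (dist-snoc G d (Adj-sym G y~z)))

        -- A walk from `c` starts towards `a` or `b`, the only neighbours of `c`; towards `a` it
        -- would bring `z` too close to `a`.
        via-b : ∀ {k} → k ≤ suc (suc j) → DistLe G c z k → ∃ λ i → suc i ≤ k × Walk G b z i
        via-b _ (_ , _ , here) = ⊥-elim (a-far (dist-adj G a~c))
        via-b k≤ (suc i , i<k , step {w = w} c~w q) with w ≟ᶠ a | w ≟ᶠ b
        ... | yes refl | _        = ⊥-elim (a-far (i , s≤s⁻¹ (≤-trans i<k k≤) , q))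
        ... | no _     | yes refl = i , i<k , q
        ... | no w≢a   | no w≢b   = ⊥-elim (three-neighbours c~w c~a c~b w≢a w≢b a≢b)

        -- On the side of `b`, the vertex `z` lies at level `j` or j + 1. By uniqueness it is then
        -- `m` or `y` itself.
        no-second-neighbour : z ≢ m → ⊥
        no-second-neighbour z≢m with DistLe? G c z (suc j)
        ... | yes d with via-b (n≤1+n _) d
        ...   | i , s≤s i≤j , q = z≢m (level-unique j (subst (Walk G b z) i≡j q , c≁z)
                  (b⇝m , λ d′ → c-far e≥ (dist-snoc G d′ m~y)))
          where
          c≁z : ¬ DistLe G c z j
          c≁z = a-far ∘ dist-step G a~c
          i≡j : i ≡ j
          i≡j = ≤-antisym i≤j (≮⇒≥ λ i<j → c≁z (suc i , i<j , step c~b q))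
        no-second-neighbour z≢m | no ¬d
          with via-b ≤-refl (subst (DistLe G c z) e≡ (centre-ecc ap z))
        ...   | i , s≤s i≤ , q with level-unique (suc j) (subst (Walk G b z) i≡ q , ¬d) (p , c-far e≥)
          where
          i≡ : i ≡ suc j
          i≡ = ≤-antisym i≤ (≮⇒≥ λ { (s≤s i≤j) → ¬d (suc i , s≤s i≤j , step c~b q) })
        ...     | refl = Adj-irrefl G y~z

    antipode⇒⊥ : 2 ≤ e → ⊥
    antipode⇒⊥ 2≤e with centre-ecc ap y
    ... | _ , _ , here = c-far (≤-trans (n≤1+n 1) 2≤e) (dist-refl G)
    ... | suc k , k<e , step c~b p with ≤-antisym (≮⇒≥ λ 1+k<e → c-far 1+k<e (suc k , ≤-refl , step c~b p)) k<e
    antipode⇒⊥ (s≤s ()) | suc zero , _ , step c~b p | refl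
    antipode⇒⊥ _ | suc (suc j) , _ , step c~b p | e≡ with second-neighbour c~b p e≡
    ... | z , y~z , z≢m = no-second-neighbour c~b p e≡ y~z z≢m

  degree≤2⇒⊥ : 2 ≤ e → ⊥
  degree≤2⇒⊥ 2≤e with other-vertex 2≤n c
  ... | v , v≢c with centre-ecc ap v
  ...   | _ , _ , here = v≢c refl
  ...   | _ , _ , step {w = a} c~a _ with ¬ecc⇒far G (ecc> ap (λ { refl → Adj-irrefl G c~a }))
  ...     | y , far = Antipode.antipode⇒⊥ c~a far 2≤e

-- Vertices with at most two non-neighbours

record CoveredUpTo (G : Graph n) (v w w′ : Fin n) : Set where
  field
    -- `w` and `w′` may coincide, so that a single non-neighbour is an instance.
    cover : ∀ u → u ≡ v ⊎ u ≡ w ⊎ u ≡ w′ ⊎ Adj G v u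
    v≁w   : ¬ Adj G v w
    v≁w′  : ¬ Adj G v w′
    w≢v   : w ≢ v
    w′≢v  : w′ ≢ v

covered-swap : {G : Graph n} {v w w′ : Fin n} → CoveredUpTo G v w w′ → CoveredUpTo G v w′ w
covered-swap P = record
  { cover = λ u → case cover u of λ where
      (inj₁ p) → inj₁ p
      (inj₂ (inj₁ p)) → inj₂ (inj₂ (inj₁ p))
      (inj₂ (inj₂ (inj₁ p))) → inj₂ (inj₁ p)
      (inj₂ (inj₂ (inj₂ p))) → inj₂ (inj₂ (inj₂ p))
  ; v≁w = v≁w′ ; v≁w′ = v≁w ; w≢v = w′≢v ; w′≢v = w≢v }
  where open CoveredUpTo P

module _ (G : Graph n) {c : Fin n} {e : ℕ} (ap : AlmostPeripheralAt G c e) (2≤e : 2 ≤ e) where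

  private
    Link : Fin n → Fin n → Set
    Link v w = ∃ λ u → Adj G v u × Adj G u w

    link? : ∀ v w → Dec (Link v w)
    link? v w = any? (λ u → Adj? G v u ×-dec Adj? G u w)

    e≤2 : ∀ {v} → v ≢ c → EccLe G v 3 → e ≤ 2
    e≤2 v≢c p = ≮⇒≥ λ 2<e → ecc> ap v≢c (ecc-mono G 2<e p)

  module _ {v w w′ : Fin n} (P : CoveredUpTo G v w w′) where
    open CoveredUpTo P

    -- Apart from `w` and `w′`, every vertex is within two steps of `x` by way of `v`.
    ecc≤2 : ∀ {x} → Adj G v x → Adj G x w → DistLe G x w′ 2 → EccLe G x 2
    ecc≤2 v~x x~w d u with cover u
    ... | inj₁ refl = dist-adj G (Adj-sym G v~x)
    ... | inj₂ (inj₁ refl) = dist-adj G x~w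
    ... | inj₂ (inj₂ (inj₁ refl)) = d
    ... | inj₂ (inj₂ (inj₂ v~u)) = dist-two G (Adj-sym G v~x) v~u

    -- Here `v` has eccentricity at most 2, so it is `c`, and its neighbour `u` forces `e ≤ 2`. A
    -- walk of length at most 3 from `w` to `w′` then shows some neighbour of `v` to have
    -- eccentricity at most 2 as well.
    both-linked⇒⊥ : Link v w → Link v w′ → ⊥
    both-linked⇒⊥ (u , v~u , u~w) (u′ , v~u′ , u′~w′) = go (dist-mono G (s≤s (e≤2 u≢c u-ecc)) (ecc≤ ap w w′))
      where
      v-ecc : EccLe G v 2
      v-ecc x with cover x
      ... | inj₁ refl = dist-refl G
      ... | inj₂ (inj₁ refl) = dist-two G v~u u~w
      ... | inj₂ (inj₂ (inj₁ refl)) = dist-two G v~u′ u′~w′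
      ... | inj₂ (inj₂ (inj₂ v~x)) = dist-adj G v~x

      u-ecc : EccLe G u 3
      u-ecc x = dist-step G (Adj-sym G v~u) (v-ecc x)

      not-centre : ∀ {x} → Adj G v x → x ≢ c
      not-centre v~x refl with ecc≤⇒≡centre G ap 2≤e v-ecc
      ... | refl = Adj-irrefl G v~x

      u≢c : u ≢ c
      u≢c = not-centre v~u

      central : ∀ {x} → Adj G v x → Adj G x w → DistLe G x w′ 2 → ⊥
      central v~x x~w d = not-centre v~x (ecc≤⇒≡centre G ap 2≤e (ecc≤2 v~x x~w d))

      go : DistLe G w w′ 3 → ⊥
      go (_ , _ , here) = central v~u u~w (dist-adj G u~w)
      go (suc k , s≤s k≤2 , step {w = x} w~x p) with cover x
      ... | inj₁ refl = v≁w (Adj-sym G w~x)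
      ... | inj₂ (inj₁ refl) = Adj-irrefl G w~x
      ... | inj₂ (inj₂ (inj₁ refl)) = central v~u u~w (dist-two G u~w w~x)
      ... | inj₂ (inj₂ (inj₂ v~x)) = central v~x (Adj-sym G w~x) (k , k≤2 , p)

    -- The only neighbour of `w′` is `w`, so each common neighbour of `v` and `w` has eccentricity
    -- at most 2 and is `c`; in particular `u` is. As `v` has eccentricity at most 3, the diameter
    -- is at most 3. Hence every neighbour of `v` is within 2 of `w`, and so equals `u` or is
    -- adjacent to it.
    one-linked : Link v w → ¬ Link v w′ → w ≢ w′ × ∃ λ u → n ≤ 2 + degree G u
    one-linked (u , v~u , u~w) ¬link =
        (λ { refl → ¬link (u , v~u , u~w) })
      , u , order≤length+degree G (u ∷ w′ ∷ []) λ x → covered x (cover x)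
      where
      only-w : ∀ {x} → Adj G w′ x → x ≡ w
      only-w {x} w′~x with cover x
      ... | inj₁ refl = ⊥-elim (v≁w′ (Adj-sym G w′~x))
      ... | inj₂ (inj₁ p) = p
      ... | inj₂ (inj₂ (inj₁ refl)) = ⊥-elim (Adj-irrefl G w′~x)
      ... | inj₂ (inj₂ (inj₂ v~x)) = ⊥-elim (¬link (x , v~x , Adj-sym G w′~x))

      w~w′ : Adj G w w′
      w~w′ with ecc≤ ap w′ v
      ... | _ , _ , here = ⊥-elim (w′≢v refl)
      ... | _ , _ , step w′~x _ with only-w w′~x
      ...   | refl = Adj-sym G w′~x

      is-centre : ∀ {x} → Adj G v x → Adj G x w → x ≡ c
      is-centre v~x x~w = ecc≤⇒≡centre G ap 2≤e (ecc≤2 v~x x~w (dist-two G x~w w~w′))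

      v≢c : v ≢ c
      v≢c refl with is-centre v~u u~w
      ... | refl = Adj-irrefl G v~u

      v-ecc : EccLe G v 3
      v-ecc = λ x → dist-step G v~u (ecc≤2 v~u u~w (dist-two G u~w w~w′) x)

      dist≤3 : ∀ x → DistLe G w′ x 3
      dist≤3 x = dist-mono G (s≤s (e≤2 v≢c v-ecc)) (ecc≤ ap w′ x)

      Covered : Fin n → Set
      Covered x = x ∈ u ∷ w′ ∷ [] ⊎ Adj G u x

      -- From `w` a walk can only go on to `w′` or to `u`, the one common neighbour of `v` and `w`.
      near : ∀ {x} → DistLe G w x 2 → Covered x
      near (_ , _ , here) = inj₂ u~w
      near (suc k , s≤s k≤1 , step {w = y} w~y p) with cover y
      ... | inj₁ refl = ⊥-elim (v≁w (Adj-sym G w~y))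
      ... | inj₂ (inj₁ refl) = ⊥-elim (Adj-irrefl G w~y)
      near (_ , s≤s _ , step w~y here) | inj₂ (inj₂ (inj₁ refl)) = inj₁ (there (here refl))
      near (_ , s≤s (s≤s z≤n) , step w~y (step w′~x here)) | inj₂ (inj₂ (inj₁ refl)) with only-w w′~x
      ... | refl = inj₂ u~w
      near (_ , s≤s _ , step w~y p) | inj₂ (inj₂ (inj₂ v~y))
        with trans (is-centre v~y (Adj-sym G w~y)) (≡-sym (is-centre v~u u~w))
      near (_ , s≤s _ , step w~y here) | inj₂ (inj₂ (inj₂ v~y)) | refl = inj₁ (here refl)
      near (_ , s≤s (s≤s z≤n) , step w~y (step y~x here)) | inj₂ (inj₂ (inj₂ v~y)) | refl = inj₂ y~x

      covered : ∀ x → x ≡ v ⊎ x ≡ w ⊎ x ≡ w′ ⊎ Adj G v x → Covered x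
      covered x (inj₁ refl) = inj₂ (Adj-sym G v~u)
      covered x (inj₂ (inj₁ refl)) = inj₂ u~w
      covered x (inj₂ (inj₂ (inj₁ refl))) = inj₁ (there (here refl))
      covered x (inj₂ (inj₂ (inj₂ v~x))) with dist≤3 x
      ... | _ , _ , here = inj₁ (there (here refl))
      ... | suc k , s≤s k≤2 , step w′~y p with only-w w′~y
      ...   | refl = near (k , k≤2 , p)

    -- Without links, `v` and its neighbours are closed under adjacency, and no walk from `v`
    -- reaches `w`.
    unlinked⇒⊥ : ¬ Link v w → ¬ Link v w′ → ⊥
    unlinked⇒⊥ ¬l ¬l′ = w∉ (walk-preserves G N closed (proj₂ (proj₂ (ecc≤ ap v w))) (inj₁ refl))
      where
      N : Fin n → Set
      N x = x ≡ v ⊎ Adj G v x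
      w∉ : ¬ N w
      w∉ = [ w≢v , v≁w ]′
      closed : ∀ {x y} → Adj G x y → N x → N y
      closed {x} {y} x~y Nx with cover y | Nx
      ... | inj₁ p | _ = inj₁ p
      ... | inj₂ (inj₁ refl) | inj₁ refl = ⊥-elim (v≁w x~y)
      ... | inj₂ (inj₁ refl) | inj₂ v~x = ⊥-elim (¬l (x , v~x , x~y))
      ... | inj₂ (inj₂ (inj₁ refl)) | inj₁ refl = ⊥-elim (v≁w′ x~y)
      ... | inj₂ (inj₂ (inj₁ refl)) | inj₂ v~x = ⊥-elim (¬l′ (x , v~x , x~y))
      ... | inj₂ (inj₂ (inj₂ p)) | _ = inj₂ p

  two-non-neighbours : ∀ {v w w′} → CoveredUpTo G v w w′ → w ≢ w′ × ∃ λ u → n ≤ 2 + degree G u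
  two-non-neighbours {v} {w} {w′} P with link? v w | link? v w′
  ... | yes l | yes l′ = ⊥-elim (both-linked⇒⊥ P l l′)
  ... | yes l | no ¬l′ = one-linked P l ¬l′
  ... | no ¬l | yes l′ with one-linked (covered-swap P) l′ ¬l
  ...   | w′≢w , big = w′≢w ∘ ≡-sym , big
  two-non-neighbours P | no ¬l | no ¬l′ = ⊥-elim (unlinked⇒⊥ P ¬l ¬l′)

-- The possible values of the maximum degree

maxDegree-range : (G : Graph n) {Δ : ℕ} → 4 ≤ n → AlmostPeripheral G → MaxDegree G Δ →
                  (3 ≤ Δ × Δ ≤ n ∸ 4) ⊎ Δ ≡ n ∸ 1
maxDegree-range {n} G {Δ} 4≤n almost (deg≤Δ , v , refl) with non-neighbours G v
... | xs , count , nonadj , cover = range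
  where
  open ≤-Reasoning
  2≤n : 2 ≤ n
  2≤n = ≤-trans (s≤s (s≤s z≤n)) 4≤n

  c   = proj₁ (almostPeripheral⇒at G 2≤n almost)
  e   = proj₁ (proj₂ (almostPeripheral⇒at G 2≤n almost))
  ap  : AlmostPeripheralAt G c e
  ap  = proj₂ (proj₂ (almostPeripheral⇒at G 2≤n almost))

  Δ<n : Δ < n
  Δ<n = m+n≤o⇒n≤o (length xs) count

  module _ (Δ+1<n : suc Δ < n) where

    2≤e : 2 ≤ e
    2≤e = ≰⇒> λ e≤1 → <-irrefl refl (begin-strict
      n                 ≤⟨ e≤1⇒dominating G ap e≤1 ⟩
      suc (degree G c)  ≤⟨ s≤s (deg≤Δ c) ⟩
      suc Δ             <⟨ Δ+1<n ⟩
      n                 ∎)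

    lower : 3 ≤ Δ
    lower = ≰⇒> λ Δ≤2 → degree≤2⇒⊥ G ap 2≤n (λ u → ≤-trans (deg≤Δ u) Δ≤2) 2≤e

    non-neighbours≥3 : ∀ xs → length xs + suc Δ ≤ n → All (λ w → w ≢ v × ¬ Adj G v w) xs →
                       (∀ u → u ≡ v ⊎ u ∈ xs ⊎ Adj G v u) → 3 ≤ length xs
    non-neighbours≥3 [] _ _ cov = ⊥-elim (<⇒≱ Δ+1<n (order≤length+degree G (v ∷ []) λ u → case cov u of λ where
      (inj₁ p) → inj₁ (here p)
      (inj₂ (inj₂ p)) → inj₂ p))
    -- A single non-neighbour is listed twice, against `w ≢ w′`.
    non-neighbours≥3 (w ∷ []) _ ((w≢v , v≁w) ∷ []) cov =
      ⊥-elim (proj₁ (two-non-neighbours G ap 2≤e covered) refl)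
      where
      covered : CoveredUpTo G v w w
      covered = record { v≁w = v≁w ; v≁w′ = v≁w ; w≢v = w≢v ; w′≢v = w≢v ; cover = λ u → case cov u of λ where
        (inj₁ p) → inj₁ p
        (inj₂ (inj₁ (here p))) → inj₂ (inj₁ p)
        (inj₂ (inj₂ p)) → inj₂ (inj₂ (inj₂ p)) }
    non-neighbours≥3 (w ∷ w′ ∷ []) cnt ((w≢v , v≁w) ∷ (w′≢v , v≁w′) ∷ []) cov
      with two-non-neighbours G ap 2≤e covered
      where
      covered : CoveredUpTo G v w w′
      covered = record { v≁w = v≁w ; v≁w′ = v≁w′ ; w≢v = w≢v ; w′≢v = w′≢v ; cover = λ u → case cov u of λ where
        (inj₁ p) → inj₁ p
        (inj₂ (inj₁ (here p))) → inj₂ (inj₁ p)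
        (inj₂ (inj₁ (there (here p)))) → inj₂ (inj₂ (inj₁ p))
        (inj₂ (inj₂ p)) → inj₂ (inj₂ (inj₂ p)) }
    -- A degree of at least n - 2 is too large, as two non-neighbours of `v` give Δ ≤ n - 3.
    ... | _ , u , n≤ = ⊥-elim (<-irrefl refl (begin-strict
      n                 ≤⟨ n≤ ⟩
      2 + degree G u    ≤⟨ s≤s (s≤s (deg≤Δ u)) ⟩
      2 + Δ             <⟨ cnt ⟩
      n                 ∎))
    non-neighbours≥3 (_ ∷ _ ∷ _ ∷ _) _ _ _ = s≤s (s≤s (s≤s z≤n))

    upper : Δ ≤ n ∸ 4
    upper = m+n≤o⇒m≤o∸n Δ (begin
      Δ + 4             ≡⟨ +-comm Δ 4 ⟩
      3 + suc Δ         ≤⟨ +-monoˡ-≤ (suc Δ) (non-neighbours≥3 xs count nonadj cover) ⟩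
      length xs + suc Δ ≤⟨ count ⟩
      n                 ∎)

  range : (3 ≤ Δ × Δ ≤ n ∸ 4) ⊎ Δ ≡ n ∸ 1
  range with m≤n⇒m<n∨m≡n Δ<n
  ... | inj₁ Δ+1<n = inj₁ (lower Δ+1<n , upper Δ+1<n)
  ... | inj₂ eq    = inj₂ (cong (_∸ 1) eq)

-- Twins

module Twin (G : Graph n) (x : Fin n) where

  π : Fin (suc n) → Fin n
  π zero    = x
  π (suc v) = v

  -- Adjacency pulled back along `π` leaves the two copies of `x` non-adjacent, with the same
  -- neighbours.
  twin : Graph (suc n)
  twin = record
    { adj = λ u v → adj G (π u) (π v)
    ; sym = λ u v → sym G (π u) (π v)
    ; irrefl = λ v → irrefl G (π v)
    }

  degree-twin : ∀ u → degree twin u ≡ (if adj G (π u) x then 1 else 0) + degree G (π u)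
  degree-twin u = cong ((if adj G (π u) x then 1 else 0) +_) (cong sum
    (trans (map-tabulate {n = n} suc (λ v → if adj twin u v then 1 else 0))
           (≡-sym (map-tabulate {n = n} id (λ v → if adj G (π u) v then 1 else 0)))))

  degree-twin-adj : ∀ {u} → Adj G (π u) x → degree twin u ≡ suc (degree G (π u))
  degree-twin-adj {u} u~x = trans (degree-twin u) (cong (λ b → (if b then 1 else 0) + degree G (π u)) u~x)

  degree-twin-nonadj : ∀ {u} → ¬ Adj G (π u) x → degree twin u ≡ degree G (π u)
  degree-twin-nonadj {u} u≁x =
    trans (degree-twin u) (cong (λ b → (if b then 1 else 0) + degree G (π u)) (¬-not u≁x))

  walk-π : ∀ {u v k} → Walk twin u v k → Walk G (π u) (π v) k
  walk-π here       = here
  walk-π (step a p) = step a (walk-π p)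

  -- Inner vertices are lifted by `suc`, while the ends may be either copy of `x`. Length 0 is
  -- excluded because the two copies are distinct with the same image.
  walk-lift : ∀ {u v a b k} → π u ≡ a → π v ≡ b → Walk G a b (suc k) → Walk twin u v (suc k)
  walk-lift refl refl (step a here) = step a here
  walk-lift refl refl (step {w = w} a p@(step _ _)) = step {w = suc w} a (walk-lift refl refl p)

  dist-lift : ∀ {u v k} → u ≡ v ⊎ (π u ≢ π v) → DistLe G (π u) (π v) k → DistLe twin u v k
  dist-lift (inj₁ refl) _ = dist-refl twin
  dist-lift (inj₂ πu≢πv) (zero , i≤k , p) = ⊥-elim (πu≢πv (walk-zero p))
    where
    walk-zero : ∀ {a b} → Walk G a b 0 → a ≡ b
    walk-zero here = refl
  dist-lift (inj₂ _) (suc i , i≤k , p) = suc i , i≤k , walk-lift refl refl p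

  π-injective-off : ∀ {u v} → π u ≡ π v → π u ≢ x → u ≡ v
  π-injective-off {zero}          _    πu≢x = ⊥-elim (πu≢x refl)
  π-injective-off {suc _} {zero}  refl πu≢x = ⊥-elim (πu≢x refl)
  π-injective-off {suc _} {suc _} refl _    = refl

  -- Distances between vertices with distinct images under `π` do not change, and the two copies of
  -- `x` are at distance 2 through `y`, which `1 ≤ e` allows. As `x ≢ c`, the vertex `c` has only
  -- one copy.
  twin-almostPeripheral : ∀ {c y e} → x ≢ c → Adj G x y → 1 ≤ e →
                          AlmostPeripheralAt G c e → AlmostPeripheralAt twin (suc c) e
  twin-almostPeripheral {c} {y} {e} x≢c x~y 1≤e ap = record
    { centre-ecc = λ u → dist-lift (dichotomy u) (centre-ecc ap (π u))
    ; ecc≤ = ecc≤′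
    ; ecc> = λ {v} v≢c p → ecc> ap (v≢c ∘ (λ πv≡c → π-injective-off πv≡c (λ πv≡x → x≢c (trans (≡-sym πv≡x) πv≡c))))
               (λ u → case p (suc u) of λ { (i , i≤e , q) → i , i≤e , walk-π q })
    }
    where
    dichotomy : ∀ u → suc c ≡ u ⊎ c ≢ π u
    dichotomy u with c ≟ᶠ π u
    ... | yes c≡πu = inj₁ (π-injective-off c≡πu (x≢c ∘ ≡-sym))
    ... | no c≢πu  = inj₂ c≢πu
    ecc≤′ : ∀ v → EccLe twin v (suc e)
    ecc≤′ v u with π v ≟ᶠ π u
    ... | no ≢πu = dist-lift (inj₂ ≢πu) (ecc≤ ap (π v) (π u))
    ... | yes πv≡πu with π v ≟ᶠ x
    ...   | no πv≢x = subst (λ a → DistLe twin v a (suc e)) (π-injective-off πv≡πu πv≢x) (dist-refl twin)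
    ...   | yes πv≡x = dist-mono twin (s≤s 1≤e) (dist-two twin {w = suc y}
              (subst (λ a → Adj G a y) (≡-sym πv≡x) x~y)
              (Adj-sym G (subst (λ a → Adj G a y) (trans (≡-sym πv≡x) πv≡πu) x~y)))

-- Twins of x raise both the order and the maximum degree by one, the latter being attained at y.

record Seed (n Δ : ℕ) : Set where
  field
    graph    : Graph n
    {c x y}  : Fin n
    {e}      : ℕ
    almost   : AlmostPeripheralAt graph c e
    1≤e      : 1 ≤ e
    degree≤  : ∀ v → degree graph v ≤ Δ
    degree-y : degree graph y ≡ Δ
    x≢c      : x ≢ c
    x~y      : Adj graph x y

grow : ∀ {Δ} → Seed n Δ → Seed (suc n) (suc Δ)
grow {Δ = Δ} S = record
  { graph = twin
  ; almost = twin-almostPeripheral x≢c x~y 1≤e almost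
  ; 1≤e = 1≤e
  ; degree≤ = λ v → ≤-trans (≤-reflexive (degree-twin v)) (+-mono-≤ (indicator≤1 _) (degree≤ (π v)))
  ; degree-y = trans (degree-twin-adj {suc y} (Adj-sym graph x~y)) (cong suc degree-y)
  ; y = suc y
  ; x≢c = x≢c ∘ suc-injective
  ; x~y = x~y
  }
  where
  open Seed S
  open Twin graph x
  indicator≤1 : ∀ b → (if b then 1 else 0) ≤ 1
  indicator≤1 true  = ≤-refl
  indicator≤1 false = z≤n

growBy : ∀ {Δ} k → Seed n Δ → Seed (k + n) (k + Δ)
growBy zero    S = S
growBy (suc k) S = grow (growBy k S)

seed⇒graph : ∀ {Δ} → Seed n Δ → Σ (Graph n) λ G → AlmostPeripheral G × MaxDegree G Δ
seed⇒graph S = graph , at⇒almostPeripheral graph x≢c almost , degree≤ , y , degree-y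
  where open Seed S

-- The condition for a twin of `z` to respect the bound `Δ`: each neighbour of `z` gains one.
Slack : Graph n → ℕ → Fin n → Set
Slack G Δ z = ∀ u → Adj G u z → degree G u < Δ

NoCommonNeighbour : Graph n → Fin n → Fin n → Set
NoCommonNeighbour G z w = ∀ u → Adj G u z → ¬ Adj G u w

module _ {Δ} (S : Seed n Δ) where
  open Seed S

  extend : ∀ z → z ≢ c → ∃ (Adj graph z) → Slack graph Δ z → Seed (suc n) Δ
  extend z z≢c (w , z~w) slack = record
    { graph = twin
    ; almost = twin-almostPeripheral z≢c z~w 1≤e almost
    ; 1≤e = 1≤e
    ; degree≤ = bound
    -- `y` already has degree `Δ`, so by slackness it is no neighbour of `z` and keeps its degree.
    ; degree-y = trans (degree-twin-nonadj {suc y} λ y~z → <-irrefl degree-y (slack y y~z)) degree-y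
    ; y = suc y
    ; x≢c = x≢c ∘ suc-injective
    ; x~y = x~y
    }
    where
    open Twin graph z
    bound : ∀ v → degree twin v ≤ Δ
    bound v with Adj? graph (π v) z
    ... | yes v~z = ≤-trans (≤-reflexive (degree-twin-adj {v} v~z)) (slack (π v) v~z)
    ... | no v≁z  = ≤-trans (≤-reflexive (degree-twin-nonadj {v} v≁z)) (degree≤ (π v))

-- Neighbours of `w` gain nothing from a twin of `z`, so several twins can be taken in succession.
slack-twin : (G : Graph n) {Δ : ℕ} (z w : Fin n) → NoCommonNeighbour G z w → Slack G Δ w →
             Slack (Twin.twin G z) Δ (suc w)
slack-twin G {Δ} z w disjoint slack u u~w =
  subst (_< Δ) (≡-sym (degree-twin-nonadj {u} λ u~z → disjoint (π u) u~z u~w)) (slack (π u) u~w)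
  where open Twin G z

-- Small orders

pathWithChords : (n : ℕ) → List (ℕ × ℕ) → Graph n
pathWithChords n chords = record
  { adj = λ u v → link (toℕ u) (toℕ v) ∨ link (toℕ v) (toℕ u)
  ; sym = λ u v → ∨-comm (link (toℕ u) (toℕ v)) _
  ; irrefl = λ v → cong₂ _∨_ (link-irrefl (toℕ v)) (link-irrefl (toℕ v))
  }
  where
  edge link : ℕ → ℕ → Bool
  edge i j = (suc i ≡ᵇ j) ∨ any (λ (a , b) → (a ≡ᵇ i) ∧ (b ≡ᵇ j)) chords
  -- Only pairs with the smaller end first count; chords are listed that way, and loops cannot
  -- arise.
  link i j = (i <ᵇ j) ∧ edge i j
  link-irrefl : ∀ i → link i i ≡ false
  link-irrefl i = cong (_∧ edge i i) (¬-not λ i<i → <-irrefl refl (<ᵇ⇒< i i (subst T (≡-sym i<i) tt)))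

module _ (G : Graph n) (Δ : ℕ) (c : Fin n) (e : ℕ) (x y : Fin n) where

  SeedConditions : Set
  SeedConditions = EccLe G c e × (∀ v → EccLe G v (suc e)) × (∀ v → v ≢ c → ¬ EccLe G v e) ×
                   1 ≤ e × (∀ v → degree G v ≤ Δ) × degree G y ≡ Δ × x ≢ c × Adj G x y

  seedConditions? : Dec SeedConditions
  seedConditions? = EccLe? G c e ×-dec all? (λ v → EccLe? G v (suc e)) ×-dec
    all? (λ v → ¬? (v ≟ᶠ c) →-dec ¬? (EccLe? G v e)) ×-dec
    1 ≤? e ×-dec all? (λ v → degree G v ≤? Δ) ×-dec degree G y ≟ Δ ×-dec ¬? (x ≟ᶠ c) ×-dec Adj? G x y

  conditions⇒seed : SeedConditions → Seed n Δ
  conditions⇒seed (p₁ , p₂ , p₃ , p₄ , p₅ , p₆ , p₇ , p₈) = record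
    { graph = G ; almost = record { centre-ecc = p₁ ; ecc≤ = p₂ ; ecc> = λ {v} → p₃ v }
    ; 1≤e = p₄ ; degree≤ = p₅ ; degree-y = p₆ ; x≢c = p₇ ; x~y = p₈ }

-- All conditions are finite, so each example is verified by evaluating `seedConditions?`.
sporadic : ∀ n {Δ} chords (c : Fin n) e x y →
           {True (seedConditions? (pathWithChords n chords) Δ c e x y)} → Seed n Δ
sporadic n c chords e x y {t} = conditions⇒seed _ _ _ _ _ _ (toWitness t)

-- The chords below were found by computer search.

path₃ : Seed 3 2
path₃ = sporadic 3 [] (# 1) 1 (# 0) (# 1)

sporadic7 : Seed 7 3
sporadic7 = sporadic 7 ((0 , 3) ∷ (0 , 5) ∷ (1 , 6) ∷ []) (# 0) 2 (# 1) (# 0)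

sporadic8 : Seed 8 3
sporadic8 = sporadic 8 ((0 , 6) ∷ (0 , 7) ∷ (1 , 4) ∷ (2 , 7) ∷ []) (# 1) 2 (# 6) (# 0)

sporadic9 : Seed 9 3
sporadic9 = sporadic 9 ((0 , 8) ∷ (1 , 3) ∷ (2 , 6) ∷ (4 , 8) ∷ []) (# 4) 2 (# 0) (# 1)

sporadic10 : Seed 10 3
sporadic10 = sporadic 10 ((0 , 9) ∷ (1 , 6) ∷ (3 , 7) ∷ (5 , 9) ∷ []) (# 6) 2 (# 0) (# 1)

sporadic11 : Seed 11 3
sporadic11 = sporadic 11 ((0 , 7) ∷ (1 , 10) ∷ (4 , 9) ∷ []) (# 9) 3 (# 0) (# 1)

sporadic12 : Seed 12 3
sporadic12 = sporadic 12 ((0 , 2) ∷ (0 , 11) ∷ (1 , 6) ∷ (4 , 9) ∷ []) (# 4) 3 (# 1) (# 0)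

sporadic13 : Seed 13 3
sporadic13 = sporadic 13 ((0 , 12) ∷ (2 , 9) ∷ (3 , 12) ∷ (6 , 11) ∷ []) (# 11) 3 (# 1) (# 2)

sporadic14 : Seed 14 3
sporadic14 = sporadic 14 ((0 , 13) ∷ (1 , 7) ∷ (4 , 11) ∷ (8 , 12) ∷ []) (# 7) 3 (# 0) (# 1)

sporadic15 : Seed 15 3
sporadic15 = sporadic 15 ((0 , 8) ∷ (0 , 14) ∷ (2 , 11) ∷ (3 , 7) ∷ (4 , 12) ∷ []) (# 2) 3 (# 1) (# 0)

sporadic16 : Seed 16 3
sporadic16 = sporadic 16 ((0 , 15) ∷ (1 , 9) ∷ (3 , 10) ∷ (4 , 15) ∷ (5 , 11) ∷ (8 , 13) ∷ []) (# 9) 3 (# 0) (# 1)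

sporadic17 : Seed 17 3
sporadic17 = sporadic 17 ((0 , 16) ∷ (1 , 5) ∷ (2 , 9) ∷ (3 , 11) ∷ (7 , 13) ∷ (10 , 15) ∷ (12 , 14) ∷ []) (# 9) 3 (# 0) (# 1)

sporadic18 : Seed 18 3
sporadic18 = sporadic 18 ((0 , 14) ∷ (0 , 17) ∷ (1 , 7) ∷ (2 , 15) ∷ (4 , 13) ∷ (5 , 9) ∷ (8 , 12) ∷ (10 , 16) ∷ []) (# 13) 3 (# 1) (# 0)

sporadic19 : Seed 19 3
sporadic19 = sporadic 19 ((0 , 6) ∷ (0 , 18) ∷ (1 , 14) ∷ (2 , 10) ∷ (3 , 17) ∷ (4 , 12) ∷ (8 , 15) ∷ (11 , 18) ∷ []) (# 1) 3 (# 6) (# 0)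

-- The ring graphs

-- The function `potential` below has `Close` values at adjacent vertices, and therefore bounds
-- distances from below.
Close : ℕ → ℕ → Set
Close a b = a ≤ suc b × b ≤ suc a

close-sym : ∀ {a b} → Close a b → Close b a
close-sym (p , q) = q , p

close-+ : ∀ k {a b} → Close a b → Close (k + a) (k + b)
close-+ k (p , q) = ≤-trans (+-monoʳ-≤ k p) (≤-reflexive (+-suc k _))
                  , ≤-trans (+-monoʳ-≤ k q) (≤-reflexive (+-suc k _))

close-⊓ : ∀ {a b a′ b′} → Close a b → Close a′ b′ → Close (a ⊓ a′) (b ⊓ b′)
close-⊓ (p , q) (p′ , q′) = ⊓-mono-≤ p p′ , ⊓-mono-≤ q q′

n∸m≤1+n∸1+m : ∀ n m → n ∸ m ≤ suc (n ∸ suc m)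
n∸m≤1+n∸1+m zero    zero    = z≤n
n∸m≤1+n∸1+m zero    (suc m) = z≤n
n∸m≤1+n∸1+m (suc n) zero    = ≤-refl
n∸m≤1+n∸1+m (suc n) (suc m) = n∸m≤1+n∸1+m n m

close-∸ : ∀ n {a b} → Close a b → Close (n ∸ a) (n ∸ b)
close-∸ n {a} {b} (p , q) = ≤-trans (n∸m≤1+n∸1+m n a) (s≤s (∸-monoʳ-≤ n q))
                          , ≤-trans (n∸m≤1+n∸1+m n b) (s≤s (∸-monoʳ-≤ n p))

close-∣-∣ : ∀ i k → Close ∣ i - k ∣ ∣ i - suc k ∣
close-∣-∣ zero    k       = ≤-trans (n≤1+n k) (n≤1+n _) , ≤-refl
close-∣-∣ (suc i) zero    = s≤s (≤-reflexive (≡-sym (∣-∣-identityʳ i))) , ≤-trans (≤-reflexive (∣-∣-identityʳ i)) (≤-trans (n≤1+n i) (n≤1+n _))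
close-∣-∣ (suc i) (suc k) = close-∣-∣ i k

-- Of two routes closing up to a walk of length at most 2d + 1, one has length at most d.
double≤⇒≤ : ∀ x y d → x + y ≤ suc (d + d) → x ≤ d ⊎ y ≤ d
double≤⇒≤ x y d h with x ≤? d | y ≤? d
... | yes p | _ = inj₁ p
... | no _  | yes q = inj₂ q
... | no p  | no q = ⊥-elim (<-irrefl refl (≤-trans
        (≤-trans (≤-reflexive (cong suc (≡-sym (+-suc d d)))) (+-mono-≤ (≰⇒> p) (≰⇒> q))) h))

module Rings (m : ℕ) (1≤m : 1 ≤ m) where

  N order : ℕ
  N     = suc (m + m)
  order = 2 + (N + N)

  data Vertex : Set where
    leaf hub : Vertex
    ring     : Bool → Fin N → Vertex

  encode : Vertex → Fin order
  encode leaf           = zero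
  encode hub            = suc zero
  encode (ring false k) = suc (suc (k ↑ˡ N))
  encode (ring true k)  = suc (suc (N ↑ʳ k))

  decode : Fin order → Vertex
  decode zero          = leaf
  decode (suc zero)    = hub
  decode (suc (suc v)) = [ ring false , ring true ]′ (splitAt N v)

  decode-encode : ∀ v → decode (encode v) ≡ v
  decode-encode leaf           = refl
  decode-encode hub            = refl
  decode-encode (ring false k) = cong [ ring false , ring true ]′ (splitAt-↑ˡ N k N)
  decode-encode (ring true k)  = cong [ ring false , ring true ]′ (splitAt-↑ʳ N N k)

  encode-decode : ∀ v → encode (decode v) ≡ v
  encode-decode zero          = refl
  encode-decode (suc zero)    = refl
  encode-decode (suc (suc v)) with splitAt N v in eq
  ... | inj₁ k = cong (λ w → suc (suc w)) (splitAt⁻¹-↑ˡ {m = N} {i = v} eq)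
  ... | inj₂ k = cong (λ w → suc (suc w)) (splitAt⁻¹-↑ʳ {m = N} {i = v} eq)

  Step : ℕ → ℕ → Set
  Step k l = suc k ≡ l ⊎ (k ≡ m + m × l ≡ 0)

  Cyclic : ℕ → ℕ → Set
  Cyclic k l = Step k l ⊎ Step l k

  Joined : Vertex → Vertex → Set
  Joined leaf       hub        = ⊤
  Joined hub        leaf       = ⊤
  Joined hub        (ring _ k) = toℕ k ≡ 0
  Joined (ring _ k) hub        = toℕ k ≡ 0
  Joined (ring s k) (ring t l) = (s ≡ t × Cyclic (toℕ k) (toℕ l)) ⊎ (s ≢ t × toℕ k ≡ m × toℕ l ≡ m)
  Joined _          _          = ⊥

  step? : ∀ k l → Dec (Step k l)
  step? k l = suc k ≟ l ⊎-dec (k ≟ m + m ×-dec l ≟ 0)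

  joined? : ∀ u v → Dec (Joined u v)
  joined? leaf       leaf       = no λ ()
  joined? leaf       hub        = yes tt
  joined? leaf       (ring _ _) = no λ ()
  joined? hub        leaf       = yes tt
  joined? hub        hub        = no λ ()
  joined? hub        (ring _ k) = toℕ k ≟ 0
  joined? (ring _ _) leaf       = no λ ()
  joined? (ring _ k) hub        = toℕ k ≟ 0
  joined? (ring s k) (ring t l) =
    (s ≟ᵇ t ×-dec (step? (toℕ k) (toℕ l) ⊎-dec step? (toℕ l) (toℕ k)))
    ⊎-dec (¬? (s ≟ᵇ t) ×-dec toℕ k ≟ m ×-dec toℕ l ≟ m)

  joined-sym : ∀ u v → Joined u v → Joined v u
  joined-sym leaf       hub        _ = tt
  joined-sym hub        leaf       _ = tt
  joined-sym hub        (ring _ _) p = p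
  joined-sym (ring _ _) hub        p = p
  joined-sym (ring s k) (ring t l) (inj₁ (p , q)) = inj₁ (≡-sym p , swap q)
  joined-sym (ring s k) (ring t l) (inj₂ (p , q , r)) = inj₂ (p ∘ ≡-sym , r , q)

  ¬step-refl : ∀ {k} → ¬ Step k k
  ¬step-refl (inj₁ p) = 1+n≢n p
  ¬step-refl (inj₂ (p , q)) = <-irrefl (trans (≡-sym q) p) (≤-trans 1≤m (m≤m+n m m))

  joined-irrefl : ∀ v → ¬ Joined v v
  joined-irrefl (ring s k) (inj₁ (_ , p)) = [ ¬step-refl , ¬step-refl ]′ p
  joined-irrefl (ring s k) (inj₂ (p , _)) = p refl

  G : Graph order
  G = record
    { adj = λ u v → does (joined? (decode u) (decode v))
    ; sym = λ u v → does-⇔ (mk⇔ (joined-sym (decode u) _) (joined-sym (decode v) _)) (joined? _ _) (joined? _ _)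
    ; irrefl = λ v → dec-false (joined? _ _) (joined-irrefl (decode v))
    }

  adj⇒joined : ∀ {u v} → Adj G u v → Joined (decode u) (decode v)
  adj⇒joined {u} {v} p with joined? (decode u) (decode v)
  ... | yes q = q
  adj⇒joined () | no _

  joined⇒adj : ∀ u v → Joined u v → Adj G (encode u) (encode v)
  joined⇒adj u v p = dec-true (joined? _ _)
    (subst₂ Joined (≡-sym (decode-encode u)) (≡-sym (decode-encode v)) p)

  -- Allows case analysis on an element of `Fin order` as on a `Vertex`.
  data View : Fin order → Set where
    vertex : ∀ v → View (encode v)

  view : ∀ v → View v
  view v = subst View (encode-decode v) (vertex (decode v))

  r : Bool → Fin N → Fin order
  r s k = encode (ring s k)

  last mid : Fin N
  last = fromℕ (m + m)
  mid  = fromℕ< (s≤s (m≤m+n m m))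

  toℕ-last : toℕ last ≡ m + m
  toℕ-last = toℕ-fromℕ (m + m)

  toℕ-mid : toℕ mid ≡ m
  toℕ-mid = toℕ-fromℕ< _

  hub~ring : ∀ s → Adj G (encode hub) (r s zero)
  hub~ring s = joined⇒adj hub (ring s zero) refl

  mid~mid : ∀ {s t} → s ≢ t → Adj G (r s mid) (r t mid)
  mid~mid {s} {t} s≢t = joined⇒adj (ring s mid) (ring t mid) (inj₂ (s≢t , toℕ-mid , toℕ-mid))

  -- Upper bounds for distances in the ring graphs

  climb : ∀ {s} d {k l : Fin N} → toℕ l ≡ d + toℕ k → Walk G (r s k) (r s l) d
  climb zero    eq with toℕ-injective eq
  ... | refl = here
  climb {s} (suc d) {k} {l} eq = walk-snoc G (climb d (toℕ-fromℕ< below))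
    (joined⇒adj (ring s (fromℕ< below)) (ring s l)
      (inj₁ (refl , inj₁ (inj₁ (trans (cong suc (toℕ-fromℕ< below)) (≡-sym eq))))))
    where
    below : d + toℕ k < N
    below = <-trans (≤-reflexive (≡-sym eq)) (toℕ<n l)

  -- Two vertices of the rings lie on a common closed walk through the vertices 0 and m of their
  -- rings, of length at most 2m + 5; each of its halves bounds the distance.
  record Arcs (s : Bool) (w : Fin order) : Set where
    field
      {d₀ dₘ} : ℕ
      d₀≤m    : d₀ ≤ m
      sum≤    : d₀ + dₘ ≤ suc m
      from₀   : Walk G (r s zero) w d₀
      toₘ     : Walk G w (r s mid) dₘ

  arcs : ∀ s k → Arcs s (r s k)
  arcs s k with toℕ k ≤? m
  ... | yes k≤m = record
    { d₀≤m = k≤m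
    ; sum≤ = ≤-trans (≤-reflexive (m+[n∸m]≡n k≤m)) (n≤1+n m)
    ; from₀ = climb (toℕ k) (≡-sym (+-identityʳ _))
    ; toₘ = climb (m ∸ toℕ k) (trans toℕ-mid (≡-sym (m∸n+n≡m k≤m)))
    }
  -- Beyond `m` the way from 0 is backwards through 2m. With k = m + 1 + j and 2m = k + i it has
  -- length i + 1, and j + 1 steps lead from k down to `m`; the sum is m + 1.
  ... | no k≰m with m≤n⇒∃[o]m+o≡n (≰⇒> k≰m) | m≤n⇒∃[o]m+o≡n (s≤s⁻¹ (toℕ<n k))
  ...   | j , j-eq | i , i-eq = record
    { d₀≤m = ≤-trans (m≤m+n (suc i) j) (≤-reflexive i+j)
    ; sum≤ = ≤-reflexive (trans (+-suc (suc i) j) (cong suc i+j))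
    ; from₀ = step wrap (walk-reverse G (climb i (trans toℕ-last (trans (≡-sym i-eq) (+-comm (toℕ k) i)))))
    ; toₘ = walk-reverse G (climb (suc j) (trans (≡-sym j-eq)
              (trans (cong suc (+-comm m j)) (cong (suc j +_) (≡-sym toℕ-mid)))))
    }
    where
    wrap : Adj G (r s zero) (r s last)
    wrap = joined⇒adj (ring s zero) (ring s last) (inj₁ (refl , inj₂ (inj₂ (toℕ-last , refl))))
    i+j : suc i + j ≡ m
    i+j = +-cancelˡ-≡ m _ _ (trans (trans (+-suc m (i + j)) (cong suc
            (trans (cong (m +_) (+-comm i j)) (≡-sym (+-assoc m j i)))))
            (trans (cong (_+ i) j-eq) i-eq))

  two-walks : ∀ {u v x y} d → x + y ≤ suc (d + d) → Walk G u v x → Walk G u v y → DistLe G u v d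
  two-walks {x = x} {y} d h p q with double≤⇒≤ x y d h
  ... | inj₁ x≤d = x , x≤d , p
  ... | inj₂ y≤d = y , y≤d , q

  hub-ecc : EccLe G (encode hub) (suc m)
  hub-ecc v with view v
  ... | vertex leaf = dist-adj G refl
  ... | vertex hub  = dist-refl G
  ... | vertex (ring s k) = suc d₀ , s≤s d₀≤m , step (hub~ring s) from₀
    where open Arcs (arcs s k)

  -- On one ring, the routes through 0 and through `m` have lengths adding up to at most 2m + 2.
  -- Between the rings the hub adds two steps and the middle edge one, giving at most 2(m + 2) + 1.
  ring-dist : ∀ s k t l → DistLe G (r s k) (r t l) (suc (suc m))
  ring-dist s k t l with s ≟ᵇ t
  ... | yes refl = dist-mono G (n≤1+n _) (two-walks (suc m)
          (≤-trans (≤-reflexive (interchange K.d₀ L.d₀ K.dₘ L.dₘ)) (≤-trans (+-mono-≤ K.sum≤ L.sum≤) (n≤1+n _)))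
          (walk-++ G (walk-reverse G K.from₀) L.from₀) (walk-++ G K.toₘ (walk-reverse G L.toₘ)))
    where
    module K = Arcs (arcs s k)
    module L = Arcs (arcs s l)
    interchange : ∀ a b c d → (a + b) + (c + d) ≡ (a + c) + (b + d)
    interchange = solve-∀
  ... | no s≢t = two-walks (suc (suc m))
          (≤-trans (≤-reflexive (interchange K.d₀ L.d₀ K.dₘ L.dₘ))
            (≤-trans (+-monoʳ-≤ 3 (+-mono-≤ K.sum≤ L.sum≤)) (≤-reflexive (total m))))
          (walk-++ G (walk-reverse G K.from₀)
            (step {w = encode hub} (Adj-sym G {encode hub} {r s zero} (hub~ring s)) (step {w = r t zero} (hub~ring t) L.from₀)))
          (walk-++ G K.toₘ (step (mid~mid s≢t) (walk-reverse G L.toₘ)))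
    where
    module K = Arcs (arcs s k)
    module L = Arcs (arcs t l)
    interchange : ∀ a b c d → (a + suc (suc b)) + (c + suc d) ≡ 3 + ((a + c) + (b + d))
    interchange = solve-∀
    total : ∀ m → 3 + (suc m + suc m) ≡ suc (suc (suc m) + suc (suc m))
    total = solve-∀

  all-ecc : ∀ v → EccLe G v (suc (suc m))
  all-ecc v u with view v | view u
  ... | vertex leaf | _ = dist-step G refl (hub-ecc u)
  ... | vertex hub | _ = dist-mono G (n≤1+n _) (hub-ecc u)
  ... | vertex v@(ring _ _) | vertex leaf = dist-snoc G (dist-sym G (hub-ecc (encode v))) refl
  ... | vertex v@(ring _ _) | vertex hub = dist-mono G (n≤1+n _) (dist-sym G (hub-ecc (encode v)))
  ... | vertex (ring s k) | vertex (ring t l) = ring-dist s k t l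

  -- Lower bounds for distances in the ring graphs

  cyc : ℕ → ℕ → ℕ
  cyc i k = ∣ i - k ∣ ⊓ (N ∸ ∣ i - k ∣)

  cyc-step : ∀ {i k l} → i ≤ m → Step k l → Close (cyc i k) (cyc i l)
  cyc-step {i} {k} _ (inj₁ refl) = close-⊓ (close-∣-∣ i k) (close-∸ N (close-∣-∣ i k))
  -- At the wrap from 2m to 0, with t = 2m - i, the values compared are min(t, i + 1) and min(i, t +
  -- 1).
  cyc-step {i} i≤m (inj₂ (refl , refl))
    with i≤2m ← ≤-trans i≤m (m≤m+n m m)
    rewrite ∣-∣-identityʳ i | m≤n⇒∣m-n∣≡n∸m i≤2m
          | +-∸-assoc 1 (m∸n≤m (m + m) i) | +-∸-assoc 1 i≤2m | m∸[m∸n]≡n i≤2m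
    = ≤-trans (≤-reflexive (⊓-comm t (suc i))) (⊓-monoʳ-≤ (suc i) (≤-trans (n≤1+n t) (n≤1+n _)))
    , ≤-trans (≤-reflexive (⊓-comm i (suc t))) (⊓-monoʳ-≤ (suc t) (≤-trans (n≤1+n i) (n≤1+n _)))
    where t = m + m ∸ i

  cyc-cyclic : ∀ {i k l} → i ≤ m → Cyclic k l → Close (cyc i k) (cyc i l)
  cyc-cyclic i≤m (inj₁ p) = cyc-step i≤m p
  cyc-cyclic i≤m (inj₂ p) = close-sym (cyc-step i≤m p)

  cyc-≤m : ∀ {i k} → i ≤ k → k ≤ m → cyc i k ≡ k ∸ i
  cyc-≤m {i} {k} i≤k k≤m rewrite m≤n⇒∣m-n∣≡n∸m i≤k =
    m≤n⇒m⊓n≡m (m+n≤o⇒m≤o∸n (k ∸ i) (≤-trans (+-mono-≤ d≤m d≤m) (n≤1+n _)))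
    where
    d≤m : k ∸ i ≤ m
    d≤m = ≤-trans (m∸n≤m k i) k≤m

  cyc-comm : ∀ i k → cyc i k ≡ cyc k i
  cyc-comm i k rewrite ∣-∣-comm i k = refl

  module Potential (s : Bool) {i : ℕ} (i≤m : i ≤ m) where

    far-side : ℕ → ℕ
    far-side k = (i + 2 + cyc 0 k) ⊓ (suc (m ∸ i) + cyc m k)

    -- The distance from the vertex i of the cycle s when i ≤ m; far-side compares the route
    -- through the hub with the one through the edge between the middle vertices.
    potential : Vertex → ℕ
    potential leaf       = i + 2
    potential hub        = i + 1
    potential (ring t k) with s ≟ᵇ t
    ... | yes _ = cyc i (toℕ k)
    ... | no _  = far-side (toℕ k)

    far-side-cyclic : ∀ {k l} → Cyclic k l → Close (far-side k) (far-side l)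
    far-side-cyclic p = close-⊓ (close-+ (i + 2) (cyc-cyclic z≤n p)) (close-+ (suc (m ∸ i)) (cyc-cyclic ≤-refl p))

    leaf-hub : Close (i + 2) (i + 1)
    leaf-hub = ≤-reflexive (+-suc i 1) , ≤-trans (+-monoʳ-≤ i (n≤1+n 1)) (n≤1+n _)

    hub-ring : ∀ t (k : Fin N) → toℕ k ≡ 0 → Close (i + 1) (potential (ring t k))
    hub-ring t k k≡0 with s ≟ᵇ t
    ... | yes _ rewrite k≡0 | cyc-comm i 0 | cyc-≤m z≤n i≤m =
          ≤-reflexive (+-comm i 1) , ≤-trans (m≤m+n i 1) (n≤1+n _)
    ... | no _ rewrite k≡0 | cyc-comm m 0 | cyc-≤m {0} z≤n (≤-refl {m}) =
            ≤-trans (≤-reflexive (+-comm i 1)) (s≤s (⊓-glb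
              (≤-trans (m≤m+n i 2) (m≤m+n _ 0)) (≤-trans i≤m (m≤n+m m _))))
          , ≤-trans (m⊓n≤m _ _) (≤-reflexive (trans (+-identityʳ _) (+-suc i 1)))

    mid-mid : ∀ {k l} → k ≡ m → l ≡ m → Close (cyc i k) (far-side l)
    mid-mid refl refl rewrite cyc-≤m i≤m ≤-refl | cyc-≤m {0} z≤n (≤-refl {m}) | cyc-≤m {m} ≤-refl ≤-refl | n∸n≡0 m =
        ≤-trans (⊓-glb (≤-trans (m∸n≤m m i) (m≤n+m m _))
                       (≤-trans (n≤1+n _) (m≤m+n _ 0))) (n≤1+n _)
      , ≤-trans (m⊓n≤n _ _) (≤-reflexive (+-identityʳ _))

    lipschitz : ∀ u v → Joined u v → Close (potential u) (potential v)
    lipschitz leaf       hub        _ = leaf-hub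
    lipschitz hub        leaf       _ = close-sym leaf-hub
    lipschitz hub        (ring t k) p = hub-ring t k p
    lipschitz (ring t k) hub        p = close-sym (hub-ring t k p)
    lipschitz (ring t k) (ring u l) p with s ≟ᵇ t | s ≟ᵇ u | p
    ... | yes _    | yes _    | inj₁ (_ , q)         = cyc-cyclic i≤m q
    ... | yes refl | yes refl | inj₂ (t≢u , _)       = ⊥-elim (t≢u refl)
    ... | yes refl | no s≢u   | inj₁ (t≡u , _)       = ⊥-elim (s≢u t≡u)
    ... | yes _    | no _     | inj₂ (_ , k≡m , l≡m) = mid-mid k≡m l≡m
    ... | no s≢t   | yes refl | inj₁ (t≡u , _)       = ⊥-elim (s≢t (≡-sym t≡u))
    ... | no _     | yes _    | inj₂ (_ , k≡m , l≡m) = close-sym (mid-mid l≡m k≡m)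
    ... | no _     | no _     | inj₁ (_ , q)         = far-side-cyclic q
    -- There are only two rings, so two sides other than `s` agree.
    ... | no s≢t   | no s≢u   | inj₂ (t≢u , _)       =
          ⊥-elim (t≢u (not-injective (trans (≡-sym (¬-not s≢t)) (¬-not s≢u))))

    -- The `Close` bounds add up along the walk. As the potential vanishes at its source, it bounds
    -- the distance from there.
    walk-potential : ∀ {u v j} → Walk G u v j → potential (decode v) ≤ j + potential (decode u)
    walk-potential here = ≤-refl
    walk-potential (step {u} {w} {k = j} a p) = ≤-trans (walk-potential p)
      (≤-trans (+-monoʳ-≤ j (proj₂ (lipschitz (decode u) (decode w) (adj⇒joined {u} {w} a))))
               (≤-reflexive (+-suc j _)))

    potential-source : ∀ {k} → toℕ k ≡ i → potential (ring s k) ≡ 0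
    potential-source {k} refl with s ≟ᵇ s
    ... | yes _  = trans (cyc-≤m {i} ≤-refl i≤m) (n∸n≡0 i)
    ... | no s≢s = ⊥-elim (s≢s refl)

    far : ∀ {k v} → toℕ k ≡ i → suc (suc m) ≤ potential v → ¬ DistLe G (r s k) (encode v) (suc m)
    far {k} {v} k≡i big (j , j≤ , p) = <-irrefl refl (begin-strict
      suc m                                        <⟨ big ⟩
      potential v                                  ≡⟨ cong potential (≡-sym (decode-encode v)) ⟩
      potential (decode (encode v))                ≤⟨ walk-potential p ⟩
      j + potential (decode (encode (ring s k)))   ≡⟨ cong (λ w → j + potential w) (decode-encode (ring s k)) ⟩
      j + potential (ring s k)                     ≡⟨ cong (j +_) (potential-source k≡i) ⟩
      j + 0                                        ≡⟨ +-identityʳ j ⟩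
      j                                            ≤⟨ j≤ ⟩
      suc m                                        ∎)
      where open ≤-Reasoning

  open Potential using (far)

  leaf-far : ∀ {s k} → toℕ k ≡ m → ¬ DistLe G (r s k) (encode leaf) (suc m)
  leaf-far {s} k≡m = far s ≤-refl {v = leaf} k≡m (≤-reflexive (+-comm 2 m))

  -- With i = `toℕ k`, the route through the hub has length at least i + 2 + (m - i), the one
  -- through the middle edge at least (m - i) + 1 + (i + 1). Both sums are m + 2.
  opposite-far : ∀ {s t k l} → s ≢ t → toℕ k < m → toℕ l ≡ m + suc (toℕ k) → ¬ DistLe G (r s k) (r t l) (suc m)
  opposite-far {s} {t} {k} {l} s≢t k<m l≡ = far s (<⇒≤ k<m) {v = ring t l} refl big
    where
    i = toℕ k
    open ≤-Reasoning
    through-hub : m ∸ i ≤ cyc 0 (m + suc i)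
    through-hub = ⊓-glb (≤-trans (m∸n≤m m i) (m≤m+n m (suc i)))
      (≤-reflexive (≡-sym (trans (cong (_∸ (m + suc i)) (≡-sym (+-suc m m))) ([m+n]∸[m+o]≡n∸o m (suc m) (suc i)))))
    through-mid : suc i ≤ cyc m (m + suc i)
    through-mid rewrite ∣m-m+n∣≡n m (suc i) =
      ⊓-glb ≤-refl (m+n≤o⇒m≤o∸n (suc i) (+-mono-≤ k<m (<⇒≤ k<m)))
    big : suc (suc m) ≤ Potential.potential s (<⇒≤ k<m) (ring t l)
    big with s ≟ᵇ t
    ... | yes s≡t = ⊥-elim (s≢t s≡t)
    ... | no _ rewrite l≡ = ⊓-glb
      (begin
        2 + m                         ≡⟨ cong (2 +_) (≡-sym (m+[n∸m]≡n (<⇒≤ k<m))) ⟩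
        2 + (i + (m ∸ i))             ≡⟨ cong (_+ (m ∸ i)) (+-comm 2 i) ⟩
        i + 2 + (m ∸ i)               ≤⟨ +-monoʳ-≤ (i + 2) through-hub ⟩
        i + 2 + cyc 0 (m + suc i)     ∎)
      (begin
        2 + m                              ≡⟨ cong (2 +_) (≡-sym (m∸n+n≡m (<⇒≤ k<m))) ⟩
        2 + (m ∸ i + i)                    ≡⟨ cong suc (≡-sym (+-suc (m ∸ i) i)) ⟩
        suc (m ∸ i) + suc i                ≤⟨ +-monoʳ-≤ (suc (m ∸ i)) through-mid ⟩
        suc (m ∸ i) + cyc m (m + suc i)    ∎)

  -- The far pairs are the leaf with a middle vertex, and k < m on one ring with m + 1 + k on the
  -- other.
  ecc-far : ∀ {v} → v ≢ encode hub → ¬ EccLe G v (suc m)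
  ecc-far {v} v≢hub ecc with view v
  ... | vertex leaf = leaf-far {true} {mid} toℕ-mid (dist-sym G (ecc (r true mid)))
  ... | vertex hub  = v≢hub refl
  ... | vertex (ring s k) with <-cmp (toℕ k) m
  ...   | tri≈ _ k≡m _ = leaf-far {s} k≡m (ecc (encode leaf))
  ...   | tri< k<m _ _ = opposite-far {s} {not s} {k} {fromℕ< below} (not-¬ refl) k<m (toℕ-fromℕ< below) (ecc _)
    where
    below : m + suc (toℕ k) < N
    below = s≤s (+-monoʳ-≤ m k<m)
  ...   | tri> _ _ m<k with m≤n⇒∃[o]m+o≡n m<k
  ...     | j , j-eq = opposite-far {not s} {s} {fromℕ< (≤-trans j<m (≤-trans (m≤m+n m m) (n≤1+n _)))} {k}
                 (not-¬ refl ∘ ≡-sym) (subst (_< m) (≡-sym (toℕ-fromℕ< _)) j<m)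
                 (trans (≡-sym j-eq) (trans (≡-sym (+-suc m j)) (cong (λ x → m + suc x) (≡-sym (toℕ-fromℕ< _)))))
                 (dist-sym G (ecc _))
    where
    j<m : j < m
    j<m = +-cancelˡ-≤ m _ _ (≤-trans (≤-reflexive (+-suc m j)) (≤-trans (≤-reflexive j-eq) (s≤s⁻¹ (toℕ<n k))))

  rings-almostPeripheral : AlmostPeripheralAt G (encode hub) (suc m)
  rings-almostPeripheral = record { centre-ecc = hub-ecc ; ecc≤ = all-ecc ; ecc> = ecc-far }

  -- Degrees in the ring graphs

  tag : Bool → ℕ
  tag false = 1
  tag true  = 2

  tag-injective : ∀ {s t} → tag s ≡ tag t → s ≡ t
  tag-injective {false} {false} _ = refl
  tag-injective {true}  {true}  _ = refl

  -- Coordinates in ℕ × ℕ let the two neighbours on a cycle be named without bound proofs.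
  code : Vertex → ℕ × ℕ
  code leaf       = 0 , 0
  code hub        = 0 , 1
  code (ring s k) = tag s , toℕ k

  code-injective : ∀ u v → code u ≡ code v → u ≡ v
  code-injective leaf           leaf           _  = refl
  code-injective hub            hub            _  = refl
  code-injective leaf           (ring false _) ()
  code-injective leaf           (ring true _)  ()
  code-injective hub            (ring false _) ()
  code-injective hub            (ring true _)  ()
  code-injective (ring false _) leaf           ()
  code-injective (ring true _)  leaf           ()
  code-injective (ring false _) hub            ()
  code-injective (ring true _)  hub            ()
  code-injective (ring s k)     (ring t l)     eq =
    cong₂ ring (tag-injective (cong proj₁ eq)) (toℕ-injective (cong proj₂ eq))

  decode-injective : ∀ {u v} → decode u ≡ decode v → u ≡ v
  decode-injective {u} {v} eq = trans (≡-sym (encode-decode u)) (trans (cong encode eq) (encode-decode v))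

  degree≤codes : ∀ v ys → (∀ u → Joined v u → code u ∈ ys) → degree G (encode v) ≤ length ys
  degree≤codes v ys h = degree≤length G {v = encode v} (decode-injective ∘ code-injective _ _) ys λ u a →
    h (decode u) (subst (λ w → Joined w (decode u)) (decode-encode v) (adj⇒joined {encode v} {u} a))

  next prev : ℕ → ℕ
  next k with k ≟ m + m
  ... | yes _ = 0
  ... | no _  = suc k
  prev zero    = m + m
  prev (suc k) = k

  cyclic⇒next⊎prev : ∀ k (l : Fin N) → Cyclic k (toℕ l) → toℕ l ≡ next k ⊎ toℕ l ≡ prev k
  cyclic⇒next⊎prev k l (inj₁ p) with k ≟ m + m | p
  ... | yes _    | inj₂ (_ , l≡0) = inj₁ l≡0
  ... | yes refl | inj₁ eq        = ⊥-elim (<-irrefl (≡-sym eq) (toℕ<n l))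
  ... | no _     | inj₁ eq        = inj₁ (≡-sym eq)
  ... | no k≢    | inj₂ (k≡ , _)  = ⊥-elim (k≢ k≡)
  cyclic⇒next⊎prev _ l (inj₂ (inj₁ refl))          = inj₂ refl
  cyclic⇒next⊎prev _ l (inj₂ (inj₂ (l≡ , refl)))   = inj₂ l≡

  -- `ys` collects the neighbours off the cycle: the hub at 0 and the other middle vertex at `m`.
  ring-degree : ∀ s k ys → (toℕ k ≡ 0 → code hub ∈ ys) → (toℕ k ≡ m → (tag (not s) , m) ∈ ys) →
                degree G (r s k) ≤ 2 + length ys
  ring-degree s k ys at-0 at-m =
    degree≤codes (ring s k) ((tag s , next (toℕ k)) ∷ (tag s , prev (toℕ k)) ∷ ys) neighbour
    where
    neighbour : ∀ u → Joined (ring s k) u → code u ∈ (tag s , next (toℕ k)) ∷ (tag s , prev (toℕ k)) ∷ ys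
    neighbour hub        p = there (there (at-0 p))
    neighbour (ring t l) (inj₁ (refl , p)) with cyclic⇒next⊎prev (toℕ k) l p
    ... | inj₁ eq = here (cong (tag s ,_) eq)
    ... | inj₂ eq = there (here (cong (tag s ,_) eq))
    neighbour (ring t l) (inj₂ (s≢t , k≡m , l≡m)) = there (there (subst (_∈ ys)
      (cong₂ (λ b → tag b ,_) (≡-sym (¬-not (s≢t ∘ ≡-sym))) (≡-sym l≡m)) (at-m k≡m)))

  ring-degree≤2 : ∀ {s k} → toℕ k ≢ 0 → toℕ k ≢ m → degree G (r s k) ≤ 2
  ring-degree≤2 {s} {k} k≢0 k≢m = ring-degree s k [] (⊥-elim ∘ k≢0) (⊥-elim ∘ k≢m)

  hub-degree≤3 : degree G (encode hub) ≤ 3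
  hub-degree≤3 = degree≤codes hub (code leaf ∷ (1 , 0) ∷ (2 , 0) ∷ []) neighbour
    where
    neighbour : ∀ u → Joined hub u → code u ∈ code leaf ∷ (1 , 0) ∷ (2 , 0) ∷ []
    neighbour leaf           _   = here refl
    neighbour (ring false k) k≡0 = there (here (cong (1 ,_) k≡0))
    neighbour (ring true k)  k≡0 = there (there (here (cong (2 ,_) k≡0)))

  degree≤3 : ∀ v → degree G v ≤ 3
  degree≤3 v with view v
  ... | vertex leaf = ≤-trans (degree≤codes leaf (code hub ∷ []) λ { hub _ → here refl }) (s≤s z≤n)
  ... | vertex hub  = hub-degree≤3
  ... | vertex (ring s k) with toℕ k ≟ 0
  ...   | yes k≡0 = ring-degree s k (code hub ∷ []) (λ _ → here refl)
                      (λ k≡m → ⊥-elim (<-irrefl (trans (≡-sym k≡0) k≡m) 1≤m))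
  ...   | no k≢0  = ring-degree s k ((tag (not s) , m) ∷ []) (⊥-elim ∘ k≢0) (λ _ → here refl)

  hub-degree : degree G (encode hub) ≡ 3
  hub-degree = ≤-antisym hub-degree≤3 (length≤degree G {encode hub} {encode leaf ∷ r false zero ∷ r true zero ∷ []}
    (((λ ()) ∷ (λ ()) ∷ []) ∷ (distinct ∷ []) ∷ [] ∷ [])
    (refl ∷ hub~ring false ∷ hub~ring true ∷ []))
    where
    distinct : r false zero ≢ r true zero
    distinct eq with trans (≡-sym (decode-encode (ring false zero)))
                           (trans (cong decode eq) (decode-encode (ring true zero)))
    ... | ()

  -- `x` is the leaf, so growing hangs further leaves on the hub.
  rings-seed : Seed order 3
  rings-seed = record
    { graph = G ; c = encode hub ; x = encode leaf ; y = encode hub ; almost = rings-almostPeripheral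
    ; 1≤e = s≤s z≤n ; degree≤ = degree≤3 ; degree-y = hub-degree ; x≢c = λ () ; x~y = refl }

  -- Leaving 0, `m` and 2m aside removes the hub, the middle edge and the edge from 2m to 0, so that
  -- only k - 1 and k + 1 remain.
  inner-neighbour : ∀ {s k u} → toℕ k ≢ 0 → toℕ k ≢ m → toℕ k ≢ m + m → Adj G u (r s k) →
                    ∃ λ l → decode u ≡ ring s l × (suc (toℕ l) ≡ toℕ k ⊎ toℕ l ≡ suc (toℕ k))
  inner-neighbour {s} {k} {u} k≢0 k≢m k≢2m u~k = go (decode u)
      (subst (Joined (decode u)) (decode-encode (ring s k)) (adj⇒joined {u} {r s k} u~k))
    where
    go : ∀ v → Joined v (ring s k) → ∃ λ l → v ≡ ring s l × (suc (toℕ l) ≡ toℕ k ⊎ toℕ l ≡ suc (toℕ k))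
    go hub        k≡0 = ⊥-elim (k≢0 k≡0)
    go (ring t l) (inj₁ (refl , inj₁ (inj₁ eq)))        = l , refl , inj₁ eq
    go (ring t l) (inj₁ (refl , inj₁ (inj₂ (_ , k≡0)))) = ⊥-elim (k≢0 k≡0)
    go (ring t l) (inj₁ (refl , inj₂ (inj₁ eq)))        = l , refl , inj₂ (≡-sym eq)
    go (ring t l) (inj₁ (refl , inj₂ (inj₂ (k≡2m , _)))) = ⊥-elim (k≢2m k≡2m)
    go (ring t l) (inj₂ (_ , _ , k≡m)) = ⊥-elim (k≢m k≡m)

-- Twins of z₁, z₂ and z₃, whose neighbourhoods are disjoint and consist of vertices of degree 2,
-- reach the orders up to that of the next ring graph without exceeding degree 3.

module Rings₄ (p : ℕ) where

  m : ℕ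
  m = 4 + p

  open Rings m (s≤s z≤n)

  2<N : 2 < N
  2<N = s≤s (s≤s (s≤s z≤n))

  m+2<N : m + 2 < N
  m+2<N = s≤s (+-monoʳ-≤ m (s≤s (s≤s z≤n)))

  -- For m ≥ 4 the neighbours 1, 3 and m + 1, m + 3 are distinct and differ from 0 and m. With m = 3
  -- the vertex 3 would be a middle vertex.
  k₂ kₘ : Fin N
  k₂ = fromℕ< 2<N
  kₘ = fromℕ< m+2<N

  -- The first three conditions make k - 1 and k + 1 the only neighbours; the others keep these away
  -- from 0 and `m`, where the degree is 3.
  Inner : Fin N → Set
  Inner k = toℕ k ≢ 0 × toℕ k ≢ m × toℕ k ≢ m + m × toℕ k ≢ 1 × toℕ k ≢ suc m × suc (toℕ k) ≢ m

  inner₂ : Inner k₂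
  inner₂ rewrite toℕ-fromℕ< 2<N = (λ ()) , (λ ()) , (λ ()) , (λ ()) , (λ ()) , (λ ())

  innerₘ : Inner kₘ
  innerₘ rewrite toℕ-fromℕ< m+2<N =
      (λ ())
    , (λ eq → absurd 1 (trans eq (≡-sym (+-identityʳ m))))
    , (λ eq → case +-cancelˡ-≡ m _ _ eq of λ ())
    , (λ ())
    , (λ eq → case +-cancelˡ-≡ m _ _ (trans eq (+-comm 1 m)) of λ ())
    , (λ eq → case +-cancelˡ-≡ m _ _ (trans (+-suc m 2) (trans eq (≡-sym (+-identityʳ m)))) of λ ())
    where
    absurd : ∀ j → m + suc j ≡ m + 0 → ⊥
    absurd j eq = case +-cancelˡ-≡ m _ _ eq of λ ()

  inner-slack : ∀ s {k} → Inner k → Slack G 3 (r s k)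
  inner-slack s {k} (k≢0 , k≢m , k≢2m , k≢1 , k≢1+m , 1+k≢m) u u~k with inner-neighbour {s} {k} {u} k≢0 k≢m k≢2m u~k
  ... | l , eq , adjacent = s≤s (subst (λ v → degree G v ≤ 2) (trans (cong encode (≡-sym eq)) (encode-decode u))
          (ring-degree≤2 {s} {l} (l≢0 adjacent) (l≢m adjacent)))
    where
    l≢0 : suc (toℕ l) ≡ toℕ k ⊎ toℕ l ≡ suc (toℕ k) → toℕ l ≢ 0
    l≢0 (inj₁ p) q = k≢1 (trans (≡-sym p) (cong suc q))
    l≢0 (inj₂ p) q = case trans (≡-sym q) p of λ ()
    l≢m : suc (toℕ l) ≡ toℕ k ⊎ toℕ l ≡ suc (toℕ k) → toℕ l ≢ m
    l≢m (inj₁ p) q = k≢1+m (trans (≡-sym p) (cong suc q))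
    l≢m (inj₂ p) q = 1+k≢m (trans (≡-sym p) q)

  ring≢hub : ∀ s k → r s k ≢ encode hub
  ring≢hub s k eq with trans (≡-sym (decode-encode (ring s k))) (cong decode eq)
  ... | ()

  has-neighbour : ∀ s k → ∃ (Adj G (r s k))
  has-neighbour s k = neighbour-exists (ring≢hub s k) (dist-sym G (hub-ecc (r s k)))
    where
    neighbour-exists : ∀ {u v d} → u ≢ v → DistLe G u v d → ∃ (Adj G u)
    neighbour-exists u≢v (_ , _ , here)     = ⊥-elim (u≢v refl)
    neighbour-exists _   (_ , _ , step {w = w} a _) = w , a

  z₁ z₂ z₃ : Fin order
  z₁ = r true k₂
  z₂ = r false k₂
  z₃ = r true kₘ

  sides-disjoint : ∀ {s t k l} → s ≢ t → Inner k → Inner l → NoCommonNeighbour G (r s k) (r t l)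
  sides-disjoint {s} {t} {k} {l} s≢t (k≢0 , k≢m , k≢2m , _) (l≢0 , l≢m , l≢2m , _) u u~k u~l
    with inner-neighbour {s} {k} {u} k≢0 k≢m k≢2m u~k | inner-neighbour {t} {l} {u} l≢0 l≢m l≢2m u~l
  ... | _ , eq , _ | _ , eq′ , _ with trans (≡-sym eq) eq′
  ...   | refl = s≢t refl

  -- Neighbours of `z₁` have index at most 3, those of `z₃` at least 4.
  z₁z₃-disjoint : NoCommonNeighbour G z₁ z₃
  z₁z₃-disjoint u u~z₁ u~z₃ with inner₂ | innerₘ
  ... | k≢0 , k≢m , k≢2m , _ | l≢0 , l≢m , l≢2m , _
    with inner-neighbour {true} {k₂} {u} k≢0 k≢m k≢2m u~z₁ | inner-neighbour {true} {kₘ} {u} l≢0 l≢m l≢2m u~z₃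
  ... | a , eq , a≈ | b , eq′ , b≈ with trans (≡-sym eq) eq′
  ...   | refl = <-irrefl refl (≤-trans (s≤s (low a≈)) (high b≈))
    where
    low : suc (toℕ a) ≡ toℕ k₂ ⊎ toℕ a ≡ suc (toℕ k₂) → toℕ a ≤ 3
    low (inj₁ p) = ≤-trans (n≤1+n _) (≤-trans (≤-reflexive (trans p (toℕ-fromℕ< 2<N))) (n≤1+n 2))
    low (inj₂ p) = ≤-reflexive (trans p (cong suc (toℕ-fromℕ< 2<N)))
    m+1≤ : ∀ {j} → suc j ≡ m + 2 → 4 ≤ j
    m+1≤ eq = s≤s⁻¹ (≤-trans (s≤s (s≤s (s≤s (s≤s (≤-trans (n≤1+n 1) (m≤n+m 2 p)))))) (≤-reflexive (≡-sym eq)))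
    high : suc (toℕ a) ≡ toℕ kₘ ⊎ toℕ a ≡ suc (toℕ kₘ) → 4 ≤ toℕ a
    high (inj₁ p) = m+1≤ (trans p (toℕ-fromℕ< m+2<N))
    high (inj₂ p) = ≤-trans (s≤s (s≤s (s≤s (s≤s z≤n)))) (≤-reflexive (≡-sym (trans p (cong suc (toℕ-fromℕ< m+2<N)))))

  lift-neighbour : ∀ {n} (H : Graph n) z v → ∃ (Adj H v) → ∃ (Adj (Twin.twin H z) (suc v))
  lift-neighbour H z v (w , a) = suc w , a

  seed₁ : Seed (1 + order) 3
  seed₁ = extend rings-seed z₁ (ring≢hub true k₂) (has-neighbour true k₂) (inner-slack true {k₂} inner₂)

  seed₂ : Seed (2 + order) 3
  seed₂ = extend seed₁ (suc z₂) (ring≢hub false k₂ ∘ suc-injective) (lift-neighbour G z₁ z₂ (has-neighbour false k₂))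
    (slack-twin G z₁ z₂ (sides-disjoint {true} {false} {k₂} {k₂} (λ ()) inner₂ inner₂)
      (inner-slack false {k₂} inner₂))

  seed₃ : Seed (3 + order) 3
  seed₃ = extend seed₂ (suc (suc z₃)) (ring≢hub true kₘ ∘ suc-injective ∘ suc-injective)
    (lift-neighbour (Seed.graph seed₁) (suc z₂) (suc z₃) (lift-neighbour G z₁ z₃ (has-neighbour true kₘ)))
    (slack-twin (Seed.graph seed₁) (suc z₂) (suc z₃)
      -- A common neighbour in the twin graph projects under `π` to one in `G`.
      (λ u → sides-disjoint {false} {true} {k₂} {kₘ} (λ ()) inner₂ innerₘ (Twin.π G z₁ u))
      (slack-twin G z₁ z₃ z₁z₃-disjoint (inner-slack true {kₘ} innerₘ)))

-- All orders and maximum degrees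

seed≥20 : ∀ j → Seed (20 + j) 3
seed≥20 j with j divMod 4
-- With j = r + 4q, the ring graph for m = 4 + q has order 20 + 4q, and r twins supply the rest.
... | result q r refl = subst (λ n → Seed n 3) (shape (toℕ r) q) (rings r)
  where
  shape : ∀ r q → r + (2 + (suc (4 + q + (4 + q)) + suc (4 + q + (4 + q)))) ≡ 20 + (r + q * 4)
  shape = solve-∀
  rings : ∀ (r : Fin 4) → Seed (toℕ r + Rings.order (4 + q) (s≤s z≤n)) 3
  rings zero                   = Rings.rings-seed (4 + q) (s≤s z≤n)
  rings (suc zero)             = Rings₄.seed₁ q
  rings (suc (suc zero))       = Rings₄.seed₂ q
  rings (suc (suc (suc zero))) = Rings₄.seed₃ q

seed≥7 : ∀ j → Seed (7 + j) 3
seed≥7 0  = sporadic7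
seed≥7 1  = sporadic8
seed≥7 2  = sporadic9
seed≥7 3  = sporadic10
seed≥7 4  = sporadic11
seed≥7 5  = sporadic12
seed≥7 6  = sporadic13
seed≥7 7  = sporadic14
seed≥7 8  = sporadic15
seed≥7 9  = sporadic16
seed≥7 10 = sporadic17
seed≥7 11 = sporadic18
seed≥7 12 = sporadic19
seed≥7 (suc (suc (suc (suc (suc (suc (suc (suc (suc (suc (suc (suc (suc j))))))))))))) = seed≥20 j

-- Twins of an end vertex turn the path into a star.
star-graph : 3 ≤ n → Σ (Graph n) λ G → AlmostPeripheral G × MaxDegree G (n ∸ 1)
star-graph 3≤n with m≤n⇒∃[o]m+o≡n 3≤n
... | j , refl = seed⇒graph (subst₂ Seed (+-comm j 3) (+-comm j 2) (growBy j path₃))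

-- Growing preserves the difference of order and maximum degree. Undoing k = Δ - 3 steps leaves
-- maximum degree 3 and order n - k, which is at least 7 because Δ ≤ n - 4.
moderate-graph : ∀ {Δ} → 7 ≤ n → 3 ≤ Δ → Δ ≤ n ∸ 4 → Σ (Graph n) λ G → AlmostPeripheral G × MaxDegree G Δ
moderate-graph {n} 7≤n 3≤Δ Δ≤n∸4 with m≤n⇒∃[o]m+o≡n 3≤Δ
... | k , refl with m≤n⇒∃[o]m+o≡n (m≤n∸o⇒o+m≤n (≤-trans (m≤n+m 4 3) 7≤n) Δ≤n∸4)
  where
  m≤n∸o⇒o+m≤n : ∀ {m n o} → o ≤ n → m ≤ n ∸ o → o + m ≤ n
  m≤n∸o⇒o+m≤n {m} {n} {o} o≤n m≤ = ≤-trans (+-monoʳ-≤ o m≤) (≤-reflexive (m+[n∸m]≡n o≤n))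
...   | j , refl = seed⇒graph (subst₂ Seed (shape k j) (+-comm k 3) (growBy k (seed≥7 j)))
  where
  shape : ∀ k j → k + (7 + j) ≡ 4 + (3 + k) + j
  shape = solve-∀

theorem10 : (n : ℕ) → 7 ≤ n → (Δ : ℕ) →
    (Σ (Graph n) λ G → AlmostPeripheral G × MaxDegree G Δ)
    ⇔ ((3 ≤ Δ × Δ ≤ n ∸ 4) ⊎ Δ ≡ n ∸ 1)
theorem10 n 7≤n Δ = mk⇔
  (λ (G , almost , maxDegree) → maxDegree-range G (≤-trans (m≤n+m 4 3) 7≤n) almost maxDegree)
  λ where
    (inj₁ (3≤Δ , Δ≤n∸4)) → moderate-graph 7≤n 3≤Δ Δ≤n∸4
    (inj₂ refl)          → star-graph (≤-trans (m≤n+m 3 4) 7≤n)
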